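{- Let $G(x)=\dfrac{1}{4\sqrt{2e^{ -x}-1}}$ for real $x<\ln2$. Then: (1) $G$ is logarithmically absolutely monotonic on $(-\infty,\ln 2)$. (2) The sequences \[ (-1)^n\sum_{k=0}^{n}(-1)^kS(n,k)(2k-1)!!,\quad n\in\{0,1,2,\dots\}, \] and \[ (-1)^n\sum_{k=1}^{n}(-1)^kS(n,k)(2k-2)!!,\quad n\in\{1,2,\dots\}, \] are positive, increasing, and logarithmically convex.
   Context: A positive infinitely differentiable function $f$ on an interval $I$ is logarithmically absolutely monotonic if $[\ln f(x)]^{(n)}\ge0$ for all $n\in\mathbb{N}$ and $x\in I$. $S(n,k)$ are the Stirling numbers of the second kind, given by $\frac{(e^x-1)^k}{k!}=\sum_{n\ge k}S(n,k)\frac{x^n}{n!}$. Double factorials: $(2k-1)!!=1\cdot3\cdots(2k-1)$ for $k\ge1$, $(-1)!!=1$, and $(2j)!!=2^jj!$ with $0!!=1$. A sequence $(s_n)$ of positive numbers is logarithmically convex if $s_n^2\le s_{n-1}s_{n+1}$ for all $n$ at which both neighbours are defined. -}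

module Defs where

open import Level using (Level; _⊔_) renaming (suc to lsuc)
open import Algebra.Apartness.Bundles using (HeytingField; HeytingCommutativeRing)
open import Algebra.Bundles using (CommutativeRing; Semiring)
import Algebra.Definitions.RawSemiring as RawSemiringOps
open import Data.Fin.Base using (toℕ)
open import Data.Integer.Base using (+_)
open import Data.Nat.Base as ℕ using (ℕ; zero; suc; _!; NonZero)
open import Data.Nat.Properties using (_!≢0)
open import Data.Product.Base using (∃; ∃-syntax; _×_; proj₁)
open import Data.Rational.Base as ℚ using (ℚ; 0ℚ; 1ℚ)
open import Data.Sum.Base using (_⊎_)
open import Relation.Binary.Core using (Rel)
open import Relation.Binary.Definitions using (Cotransitive)
open import Relation.Binary.Structures using (IsStrictPartialOrder)
open import Relation.Nullary.Negation using (¬_)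

private
  variable
    c ℓ₁ ℓ₂ ℓ : Level

-- ℝ is treated axiomatically, as an arbitrary Archimedean, Cauchy complete
-- ordered field.  The axioms are the constructive ones: the order is
-- cotransitive rather than trichotomous, and reciprocals exist for elements
-- apart from zero.  The classical reals and the Bishop reals are both models.

record OrderedHeytingField c ℓ₁ ℓ₂ : Set (lsuc (c ⊔ ℓ₁ ⊔ ℓ₂)) where
  infix 4 _<_ _≤_
  field
    heytingField : HeytingField c ℓ₁ ℓ₂
  open HeytingField heytingField public

  field
    _<_                  : Rel Carrier ℓ₂
    isStrictPartialOrder : IsStrictPartialOrder _≈_ _<_
    <-cotrans            : Cotransitive _<_
    <⇒#                  : ∀ {x y} → x < y → x # y
    #⇒<⊎>                : ∀ {x y} → x # y → x < y ⊎ y < x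
    0<1                  : 0# < 1#
    +-monoˡ-<            : ∀ z {x y} → x < y → x + z < y + z
    *-pos                : ∀ {x y} → 0# < x → 0# < y → 0# < x * y

  module < = IsStrictPartialOrder isStrictPartialOrder

  _≤_ : Rel Carrier ℓ₂
  x ≤ y = ¬ (y < x)

  commutativeRing : CommutativeRing c ℓ₁
  commutativeRing = HeytingCommutativeRing.commutativeRing heytingCommutativeRing

  open RawSemiringOps (Semiring.rawSemiring (CommutativeRing.semiring commutativeRing)) public
    using (sum; _^_) renaming (_×_ to _·_)

  fromℕ : ℕ → Carrier
  fromℕ n = n · 1#

  -- ∣ x - y ∣ < ε
  Within : Carrier → Carrier → Carrier → Set ℓ₂
  Within ε x y = (- ε < x - y) × (x - y < ε)

  ConvergesTo : (ℕ → Carrier) → Carrier → Set (c ⊔ ℓ₂)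
  ConvergesTo s l = ∀ ε → 0# < ε → ∃[ N ] ∀ n → N ℕ.≤ n → Within ε (s n) l

  Cauchy : (ℕ → Carrier) → Set (c ⊔ ℓ₂)
  Cauchy s = ∀ ε → 0# < ε →
    ∃[ N ] ∀ m n → N ℕ.≤ m → N ℕ.≤ n → Within ε (s m) (s n)

  -- #⇒invertible at y = 0# yields an inverse of x - 0#, which is ≈ x.
  recip : ∀ {x} → x # 0# → Carrier
  recip x#0 = proj₁ (#⇒invertible x#0)

  0<fromℕ : ∀ n → 0# < fromℕ (suc n)
  0<fromℕ zero    = <.<-respʳ-≈ (sym (+-identityʳ 1#)) 0<1
  0<fromℕ (suc n) =
    <.trans (0<fromℕ n)
      (<.<-respˡ-≈ (+-identityˡ _) (+-monoˡ-< (fromℕ (suc n)) 0<1))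

  fromℕ#0 : ∀ n → .{{NonZero n}} → fromℕ n # 0#
  fromℕ#0 (suc n) = #-sym (<⇒# (0<fromℕ n))

record RealNumbers c ℓ₁ ℓ₂ : Set (lsuc (c ⊔ ℓ₁ ⊔ ℓ₂)) where
  field
    orderedHeytingField : OrderedHeytingField c ℓ₁ ℓ₂
  open OrderedHeytingField orderedHeytingField public

  field
    archimedean : ∀ x → ∃[ n ] x < fromℕ n
    complete    : ∀ s → Cauchy s → ∃[ l ] ConvergesTo s l

-- exp, ln and the square root.  Each is determined up to ≈ by the fields
-- below: exp as the sum of its power series, ln as the inverse of exp.
-- Partial functions take a proof that the argument lies in the domain.

record ElementaryFunctions (R : RealNumbers c ℓ₁ ℓ₂) : Set (c ⊔ ℓ₁ ⊔ ℓ₂) where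
  open RealNumbers R

  expPartialSum : Carrier → ℕ → Carrier
  expPartialSum x n =
    sum {n} λ i → let k = toℕ i in x ^ k * recip (fromℕ#0 (k !) {{k !≢0}})

  field
    exp        : Carrier → Carrier
    exp-series : ∀ x → ConvergesTo (expPartialSum x) (exp x)

    ln         : ∀ x → 0# < x → Carrier
    exp-ln     : ∀ x (0<x : 0# < x) → exp (ln x 0<x) ≈ x

    sqrt       : ∀ x → 0# ≤ x → Carrier
    0≤sqrt     : ∀ x (0≤x : 0# ≤ x) → 0# ≤ sqrt x 0≤x
    sqrt*sqrt  : ∀ x (0≤x : 0# ≤ x) → sqrt x 0≤x * sqrt x 0≤x ≈ x

module Analysis (R : RealNumbers c ℓ₁ ℓ₂) where
  open RealNumbers R

  record Interval ℓ : Set (c ⊔ ℓ₁ ⊔ ℓ₂ ⊔ lsuc ℓ) where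
    field
      Mem    : Carrier → Set ℓ
      resp   : ∀ {x y} → x ≈ y → Mem x → Mem y
      convex : ∀ {x y z} → Mem x → Mem z → x < y → y < z → Mem y
  open Interval public

  Below : Carrier → Interval ℓ₂
  Below a = record
    { Mem    = λ x → x < a
    ; resp   = <.<-respˡ-≈
    ; convex = λ _ z<a _ y<z → <.trans y<z z<a
    }

  FunctionOn : Interval ℓ → Set (c ⊔ ℓ)
  FunctionOn I = ∀ x → Mem I x → Carrier

  -- #⇒invertible y#x provides the inverse of y - x.
  IsDerivative : (I : Interval ℓ) → (f f′ : FunctionOn I) → Set (c ⊔ ℓ₂ ⊔ ℓ)
  IsDerivative I f f′ = ∀ x (x∈I : Mem I x) ε → 0# < ε →
    ∃[ δ ] 0# < δ × (∀ y (y∈I : Mem I y) (y#x : y # x) → Within δ y x →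
      Within ε ((f y y∈I - f x x∈I) * proj₁ (#⇒invertible y#x)) (f′ x x∈I))

  record IteratedDerivatives (I : Interval ℓ) (f : FunctionOn I)
                             (D : ℕ → FunctionOn I) : Set (c ⊔ ℓ₁ ⊔ ℓ₂ ⊔ ℓ) where
    field
      base : ∀ x (x∈I : Mem I x) → D 0 x x∈I ≈ f x x∈I
      step : ∀ n → IsDerivative I (D n) (D (suc n))

  Positive : (I : Interval ℓ) → FunctionOn I → Set (c ⊔ ℓ₂ ⊔ ℓ)
  Positive I f = ∀ x (x∈I : Mem I x) → 0# < f x x∈I

  InfinitelyDifferentiable : (I : Interval ℓ) → FunctionOn I →
                             Set (c ⊔ ℓ₁ ⊔ ℓ₂ ⊔ ℓ)
  InfinitelyDifferentiable I f = ∃ (IteratedDerivatives I f)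

  module _ (E : ElementaryFunctions R) where
    open ElementaryFunctions E

    -- The derivatives of ln f are required to be nonnegative for orders n ≥ 1
    -- only; ln f itself may have any sign.
    record LogAbsolutelyMonotonic (I : Interval ℓ) (f : FunctionOn I) :
                                  Set (c ⊔ ℓ₁ ⊔ ℓ₂ ⊔ ℓ) where
      field
        positive : Positive I f
        smooth   : InfinitelyDifferentiable I f

      ln∘f : FunctionOn I
      ln∘f x x∈I = ln (f x x∈I) (positive x x∈I)

      field
        lnDerivative              : ℕ → FunctionOn I
        lnDerivative-isDerivative : IteratedDerivatives I ln∘f lnDerivative
        lnDerivative-nonneg       : ∀ n → 1 ℕ.≤ n → ∀ x (x∈I : Mem I x) →
                                    0# ≤ lnDerivative n x x∈I

    ln2 : Carrier
    ln2 = ln (fromℕ 2) (0<fromℕ 1)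

    radicand : Carrier → Carrier
    radicand x = fromℕ 2 * exp (- x) - 1#

    -- What the expression 1 / (4 √(2 e⁻ˣ - 1)) requires in order to make sense.
    record GDefinedAt (x : Carrier) : Set ℓ₂ where
      field
        0≤radicand    : 0# ≤ radicand x
      denominator : Carrier
      denominator = fromℕ 4 * sqrt (radicand x) 0≤radicand
      field
        denominator#0 : denominator # 0#

    G : ∀ x → GDefinedAt x → Carrier
    G x def = recip (GDefinedAt.denominator#0 def)

open RawSemiringOps ℚ.+-*-rawSemiring using (_^_) renaming (sum to sumℚ)

infixl 7 _⊛_

-- Formal power series over ℚ, given by their coefficients.
Series : Set
Series = ℕ → ℚ

one : Series
one zero    = 1ℚ
one (suc _) = 0ℚ

_⊛_ : Series → Series → Series
(f ⊛ g) n = sumℚ {suc n} λ i → f (toℕ i) ℚ.* g (n ℕ.∸ toℕ i)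

power : Series → ℕ → Series
power f zero    = one
power f (suc k) = f ⊛ power f k

1/_! : ℕ → ℚ
1/ n ! = ((+ 1) ℚ./ (n !)) {{n !≢0}}

expSeries : Series
expSeries n = 1/ n !

expSeries-1 : Series
expSeries-1 n = expSeries n ℚ.- one n

fromℕℚ : ℕ → ℚ
fromℕℚ n = (+ n) ℚ./ 1

-- n! times the coefficient of xⁿ in (eˣ - 1)ᵏ / k!.
S : ℕ → ℕ → ℚ
S n k = fromℕℚ (n !) ℚ.* (power expSeries-1 k n ℚ.* 1/ k !)

[2_-1]!! : ℕ → ℕ
[2 zero  -1]!! = 1
[2 suc k -1]!! = (2 ℕ.* k ℕ.+ 1) ℕ.* [2 k -1]!!

[2_]!! : ℕ → ℕ
[2 j ]!! = 2 ℕ.^ j ℕ.* j !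

sign : ℕ → ℚ
sign n = (ℚ.- 1ℚ) ^ n

oddSequence : ℕ → ℚ
oddSequence n = sign n ℚ.* sumℚ {suc n} λ i → let k = toℕ i in
  sign k ℚ.* S n k ℚ.* fromℕℚ [2 k -1]!!

-- Here i = k - 1 runs from 0 to n - 1, so that (2k-2)!! = (2i)!!.
evenSequence : ℕ → ℚ
evenSequence n = sign n ℚ.* sumℚ {n} λ i → let k = suc (toℕ i) in
  sign k ℚ.* S n k ℚ.* fromℕℚ [2 toℕ i ]!!

-- Properties of the sequence (s n) with n ≥ a.

PositiveFrom : ℕ → (ℕ → ℚ) → Set
PositiveFrom a s = ∀ n → a ℕ.≤ n → 0ℚ ℚ.< s n

-- In the weak sense: both sequences above begin with 1, 1.
IncreasingFrom : ℕ → (ℕ → ℚ) → Set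
IncreasingFrom a s = ∀ m n → a ℕ.≤ m → m ℕ.≤ n → s m ℚ.≤ s n

LogConvexFrom : ℕ → (ℕ → ℚ) → Set
LogConvexFrom a s =
  ∀ n → a ℕ.< n → s n ℚ.* s n ℚ.≤ s (ℕ.pred n) ℚ.* s (suc n)

{-# OPTIONS --safe #-}

{-
Real part.  Put e = exp x, u = 1 / (2 - e) and g = G x, so that 16 g² = e u.  Then e′ = e, u′ = e u u, g′ = g u and
(ln g)′ = u, so all derivatives of g and of ln g are polynomials in e, u, g with nonnegative coefficients.  Of exp only the
functional equation and 1 + x ≤ exp x are used: the latter squeezes the difference quotients of exp ∘ f and of logarithms.

Rational part.  Since u′ = 2u² - u, the n-th derivatives of g and of u are g p(u) and u q(u) with polynomials p, q, and the
weighted Stirling sums are p(1) and q(1), that is, 4 g⁽ⁿ⁾ and u⁽ⁿ⁾ at x = 0.  In powers of u - 1, differentiation becomes a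
tridiagonal matrix with nonnegative entries and nonnegative 2×2 minors.  So, by Cauchy–Binet, consecutive rows of the triangle
of coefficients have nonnegative 2×2 minors, and its first column is log-convex.
-}

module Submission where

open import Defs

open import Algebra.Bundles using (CommutativeRing; Semiring)
import Algebra.Apartness.Properties.HeytingCommutativeRing
import Algebra.Definitions.RawSemiring
import Algebra.Properties.AbelianGroup
import Algebra.Properties.Ring
import Algebra.Properties.Semiring.Mult
import Algebra.Properties.Semiring.Mult.TCOptimised
import Algebra.Solver.Ring
open import Algebra.Solver.Ring.AlmostCommutativeRing as ACR using (_-Raw-AlmostCommutative⟶_)
open import Data.Empty using (⊥-elim)
open import Data.Fin.Base using (toℕ)
open import Data.Integer.Base as ℤ using (ℤ; +_; -[1+_]; _⊖_; _◃_)
import Data.Integer.Properties as ℤ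
open import Data.Maybe.Base as Maybe using ()
open import Data.Nat.Base as ℕ using (ℕ; zero; suc; _!; NonZero)
open import Data.Nat.Combinatorics using (_C_; nC1≡n; nCk+nC[k+1]≡[n+1]C[k+1])
open import Data.Nat.Properties as ℕ using (_!≢0)
open import Data.Nat.Solver using (module +-*-Solver)
open import Data.Product using (∃-syntax; Σ-syntax; _×_; _,_; proj₁; proj₂)
open import Data.Rational.Base as ℚ using (ℚ; 0ℚ; 1ℚ)
import Data.Rational.Properties as ℚ
open import Data.Rational.Unnormalised.Base as ℚᵘ using (mkℚᵘ; *≡*; *≤*)
import Data.Rational.Unnormalised.Properties as ℚᵘ
import Data.Sign.Base as Sign
open import Data.Sum.Base using (_⊎_; inj₁; inj₂; [_,_]′)
open import Function.Base using (_∘_)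
open import Level using (_⊔_) renaming (suc to lsuc)
open import Relation.Binary.PropositionalEquality.Core as ≡ using (_≡_)
open import Relation.Binary.PropositionalEquality.Properties using (module ≡-Reasoning)
import Relation.Binary.Reasoning.Setoid
open import Relation.Nullary.Decidable using (dec⇒maybe)

-- The axioms give `ln` only as a right inverse of `exp` and `sqrt` only through its square; neither
-- is assumed continuous. Hence an unusual order of differentiation: for M = 2 ln g, exp M is
-- rational in exp, which yields the derivative of M, then that of ln g, and only then that of g =
-- exp (ln g). The order relation is constructive, so case splits on signs give way to
-- cotransitivity and to refuting strict inequalities. In powers of u the alternating signs of the
-- Stirling sums persist. Passing to v = u - 1 removes them, because u′ = (1 + v)(1 + 2v) has
-- positive coefficients, and it turns evaluation at u = 1 into reading off the constant
-- coefficient. The rational half is formal: polynomials are arrays of coefficients, the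
-- substitution u = 1 + v is a binomial sum, and the functions of a real variable serve only as
-- motivation.

-- Ring identities with integer coefficients

module IntegerSolver {c ℓ} (CR : CommutativeRing c ℓ) where
  open CommutativeRing CR
  open Algebra.Properties.Ring ring
  open Algebra.Properties.AbelianGroup +-abelianGroup using (⁻¹-∙-comm; ⁻¹-involutive; ε⁻¹≈ε)
  open Algebra.Properties.Semiring.Mult.TCOptimised semiring renaming (_×_ to _·_)
  open Relation.Binary.Reasoning.Setoid setoid

  -- Integer coefficients have decidable equality, which the ring itself need not have, so the
  -- solver can recognise constants that cancel. With the optimised multiple, `1 · 1#` is `1#` by
  -- definition, so `con (+ 1)` denotes `1#` itself.
  fromℤ : ℤ → Carrier
  fromℤ (+ n)    = n · 1#
  fromℤ -[1+ n ] = - (suc n · 1#)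

  fromℤ-neg : ∀ i → fromℤ (ℤ.- i) ≈ - fromℤ i
  fromℤ-neg (+ zero)  = sym ε⁻¹≈ε
  fromℤ-neg (+ suc n) = refl
  fromℤ-neg -[1+ n ]  = sym (⁻¹-involutive _)

  fromℤ-⊖ : ∀ m n → fromℤ (m ⊖ n) ≈ m · 1# - n · 1#
  fromℤ-⊖ zero    zero    = sym (-‿inverseʳ 0#)
  fromℤ-⊖ zero    (suc n) = sym (+-identityˡ _)
  fromℤ-⊖ (suc m) zero    = sym (trans (+-congˡ ε⁻¹≈ε) (+-identityʳ _))
  fromℤ-⊖ (suc m) (suc n) = begin
    fromℤ (suc m ⊖ suc n)                    ≡⟨ ≡.cong fromℤ (ℤ.[1+m]⊖[1+n]≡m⊖n m n) ⟩
    fromℤ (m ⊖ n)                            ≈⟨ fromℤ-⊖ m n ⟩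
    m · 1# - n · 1#                          ≈⟨ +-congʳ (+-identityʳ _) ⟨
    m · 1# + 0# - n · 1#                     ≈⟨ +-congʳ (+-congˡ (-‿inverseʳ 1#)) ⟨
    m · 1# + (1# - 1#) - n · 1#              ≈⟨ +-congʳ (+-assoc _ _ _) ⟨
    m · 1# + 1# - 1# - n · 1#                ≈⟨ +-assoc _ _ _ ⟩
    m · 1# + 1# + (- 1# - n · 1#)            ≈⟨ +-cong (trans (+-comm _ _) (sym (1+× m 1#)))
        (trans (⁻¹-∙-comm _ _) (-‿cong (sym (1+× n 1#)))) ⟩
    suc m · 1# - suc n · 1#                  ∎

  fromℤ-+ : ∀ i j → fromℤ (i ℤ.+ j) ≈ fromℤ i + fromℤ j
  fromℤ-+ (+ m)    (+ n)    = ×-homo-+ 1# m n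
  fromℤ-+ (+ m)    -[1+ n ] = fromℤ-⊖ m (suc n)
  fromℤ-+ -[1+ m ] (+ n)    = trans (fromℤ-⊖ n (suc m)) (+-comm _ _)
  fromℤ-+ -[1+ m ] -[1+ n ] = begin
    - (suc (suc (m ℕ.+ n)) · 1#)         ≡⟨ ≡.cong (λ k → - (suc k · 1#)) (≡.sym (ℕ.+-suc m n)) ⟩
    - ((suc m ℕ.+ suc n) · 1#)           ≈⟨ -‿cong (×-homo-+ 1# (suc m) (suc n)) ⟩
    - (suc m · 1# + suc n · 1#)          ≈⟨ ⁻¹-∙-comm _ _ ⟨
    - (suc m · 1#) + - (suc n · 1#)      ∎

  fromℤ-◃⁻ : ∀ n → fromℤ (Sign.- ◃ n) ≈ - (n · 1#)
  fromℤ-◃⁻ zero    = sym ε⁻¹≈ε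
  fromℤ-◃⁻ (suc n) = refl

  fromℤ-* : ∀ i j → fromℤ (i ℤ.* j) ≈ fromℤ i * fromℤ j
  fromℤ-* (+ m)    (+ n)    = trans (reflexive (≡.cong fromℤ (ℤ.+◃n≡+n (m ℕ.* n)))) (×1-homo-* m n)
  fromℤ-* (+ m)    -[1+ n ] = trans (fromℤ-◃⁻ (m ℕ.* suc n)) (trans (-‿cong (×1-homo-* m (suc n))) (-‿distribʳ-* _ _))
  fromℤ-* -[1+ m ] (+ n)    = trans (fromℤ-◃⁻ (suc m ℕ.* n)) (trans (-‿cong (×1-homo-* (suc m) n)) (-‿distribˡ-* _ _))
  fromℤ-* -[1+ m ] -[1+ n ] = begin
    (suc m ℕ.* suc n) · 1#               ≈⟨ ×1-homo-* (suc m) (suc n) ⟩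
    suc m · 1# * suc n · 1#              ≈⟨ ⁻¹-involutive _ ⟨
    - - (suc m · 1# * suc n · 1#)        ≈⟨ -‿cong (-‿distribˡ-* _ _) ⟩
    - (- (suc m · 1#) * suc n · 1#)      ≈⟨ -‿distribʳ-* _ _ ⟩
    - (suc m · 1#) * - (suc n · 1#)      ∎

  fromℤ-homomorphism : ℤ.+-*-rawRing -Raw-AlmostCommutative⟶ ACR.fromCommutativeRing CR
  fromℤ-homomorphism = record
    { ⟦_⟧    = fromℤ
    ; +-homo = fromℤ-+
    ; *-homo = fromℤ-*
    ; -‿homo = fromℤ-neg
    ; 0-homo = refl
    ; 1-homo = refl
    }

  open Algebra.Solver.Ring ℤ.+-*-rawRing (ACR.fromCommutativeRing CR) fromℤ-homomorphism
    (λ i j → Maybe.map (reflexive ∘ ≡.cong fromℤ) (dec⇒maybe (i ℤ.≟ j))) public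
    using (solve; _:=_; _:+_; _:*_; _:-_; :-_; con)

-- Finite sums, Cauchy products and formal derivatives

module Sequences {c ℓ} (CR : CommutativeRing c ℓ) where
  open CommutativeRing CR
  open Algebra.Definitions.RawSemiring (Semiring.rawSemiring semiring) using (sum) renaming (_×_ to _·_) public
  open Relation.Binary.Reasoning.Setoid setoid
  open IntegerSolver CR

  infixl 7 _⋆_
  infix  4 _≋_

  _≋_ : (f g : ℕ → Carrier) → Set ℓ
  f ≋ g = ∀ n → f n ≈ g n

  ν : ℕ → Carrier
  ν n = n · 1#

  ν1≈1 : ν 1 ≈ 1#
  ν1≈1 = +-identityʳ 1#

  ν-+ : ∀ m n → ν (m ℕ.+ n) ≈ ν m + ν n
  ν-+ = Algebra.Properties.Semiring.Mult.×-homo-+ semiring 1#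

  ν-* : ∀ m n → ν (m ℕ.* n) ≈ ν m * ν n
  ν-* = Algebra.Properties.Semiring.Mult.×1-homo-* semiring

  Σ< : (ℕ → Carrier) → ℕ → Carrier
  Σ< f n = sum {n} (f ∘ toℕ)

  _⋆_ : (f g : ℕ → Carrier) → ℕ → Carrier
  (f ⋆ g) n = sum {suc n} λ i → f (toℕ i) * g (n ℕ.∸ toℕ i)

  scale : Carrier → (ℕ → Carrier) → ℕ → Carrier
  scale a f n = a * f n

  -- The coefficients of the derivative of Σ f n xⁿ.
  ∂ : (ℕ → Carrier) → ℕ → Carrier
  ∂ f n = ν (suc n) * f (suc n)

  Σ<-cong : ∀ {f g} → f ≋ g → Σ< f ≋ Σ< g
  Σ<-cong f≋g zero    = refl
  Σ<-cong f≋g (suc n) = +-cong (f≋g 0) (Σ<-cong (f≋g ∘ suc) n)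

  Σ<-last : ∀ f n → Σ< f (suc n) ≈ Σ< f n + f n
  Σ<-last f zero    = +-comm _ _
  Σ<-last f (suc n) = trans (+-congˡ (Σ<-last (f ∘ suc) n)) (sym (+-assoc _ _ _))

  Σ<-+ : ∀ f g n → Σ< (λ i → f i + g i) n ≈ Σ< f n + Σ< g n
  Σ<-+ f g zero    = sym (+-identityʳ 0#)
  Σ<-+ f g (suc n) = trans (+-congˡ (Σ<-+ (f ∘ suc) (g ∘ suc) n))
    (solve 4 (λ a b c d → (a :+ b) :+ (c :+ d) := (a :+ c) :+ (b :+ d)) refl (f 0) (g 0) _ _)

  Σ<-scale : ∀ a f n → Σ< (scale a f) n ≈ a * Σ< f n
  Σ<-scale a f zero    = sym (zeroʳ a)
  Σ<-scale a f (suc n) = trans (+-congˡ (Σ<-scale a (f ∘ suc) n)) (sym (distribˡ _ _ _))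

  ⋆-cong : ∀ {f f′ g g′} → f ≋ f′ → g ≋ g′ → f ⋆ g ≋ f′ ⋆ g′
  ⋆-cong f≋f′ g≋g′ zero    = +-congʳ (*-cong (f≋f′ 0) (g≋g′ 0))
  ⋆-cong f≋f′ g≋g′ (suc n) = +-cong (*-cong (f≋f′ 0) (g≋g′ (suc n))) (⋆-cong (f≋f′ ∘ suc) g≋g′ n)

  ⋆-distribʳ : ∀ f g h → (λ i → f i + g i) ⋆ h ≋ (λ n → (f ⋆ h) n + (g ⋆ h) n)
  ⋆-distribʳ f g h zero    = solve 3 (λ a b c → (a :+ b) :* c :+ con (+ 0) := (a :* c :+ con (+ 0)) :+
      (b :* c :+ con (+ 0))) refl _ _ _
  ⋆-distribʳ f g h (suc n) = trans (+-congˡ (⋆-distribʳ (f ∘ suc) (g ∘ suc) h n))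
    (solve 5 (λ a b c d e → (a :+ b) :* c :+ (d :+ e) := (a :* c :+ d) :+ (b :* c :+ e)) refl _ _ _ _ _)

  ⋆-distribˡ : ∀ f g h → f ⋆ (λ i → g i + h i) ≋ (λ n → (f ⋆ g) n + (f ⋆ h) n)
  ⋆-distribˡ f g h zero    = solve 3 (λ a b c → a :* (b :+ c) :+ con (+ 0) := (a :* b :+ con (+ 0)) :+
      (a :* c :+ con (+ 0))) refl _ _ _
  ⋆-distribˡ f g h (suc n) = trans (+-congˡ (⋆-distribˡ (f ∘ suc) g h n))
    (solve 5 (λ a b c d e → a :* (b :+ c) :+ (d :+ e) := (a :* b :+ d) :+ (a :* c :+ e)) refl _ _ _ _ _)

  scale-⋆ : ∀ a f g → scale a f ⋆ g ≋ scale a (f ⋆ g)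
  scale-⋆ a f g zero    = solve 3 (λ a b c → a :* b :* c :+ con (+ 0) := a :* (b :* c :+ con (+ 0))) refl _ _ _
  scale-⋆ a f g (suc n) = trans (+-congˡ (scale-⋆ a (f ∘ suc) g n))
    (solve 4 (λ a b c d → a :* b :* c :+ a :* d := a :* (b :* c :+ d)) refl _ _ _ _)

  ⋆-scale : ∀ a f g → f ⋆ scale a g ≋ scale a (f ⋆ g)
  ⋆-scale a f g zero    = solve 3 (λ a b c → b :* (a :* c) :+ con (+ 0) := a :* (b :* c :+ con (+ 0))) refl _ _ _
  ⋆-scale a f g (suc n) = trans (+-congˡ (⋆-scale a (f ∘ suc) g n))
    (solve 4 (λ a b c d → b :* (a :* c) :+ a :* d := a :* (b :* c :+ d)) refl _ _ _ _)

  -- The weight n + 1 of `f i * g (n + 1 - i)` splits as i + (n + 1 - i). The induction peels off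
  -- the term with `f 0`.
  leibniz : ∀ f g → ∂ (f ⋆ g) ≋ (λ n → (∂ f ⋆ g) n + (f ⋆ ∂ g) n)
  leibniz f g zero    =
    solve 5 (λ o a b c d → o :* (a :* d :+ (c :* b :+ con (+ 0)))
                        := (o :* c) :* b :+ con (+ 0) :+ (a :* (o :* d) :+ con (+ 0))) refl _ (f 0) (g 0) (f 1) (g 1)
  leibniz f g (suc n) = begin
    (1# + ν (suc n)) * (f 0 * g (2 ℕ.+ n) + (f₁ ⋆ g) (suc n))
      ≈⟨ solve 4 (λ m a b x → (con (+ 1) :+ m) :* (a :* b :+ x) := a :* ((con (+ 1) :+ m) :* b) :+ x :+ m :* x) refl
          _ _ _ _ ⟩
    f 0 * ∂ g (suc n) + (f₁ ⋆ g) (suc n) + ν (suc n) * (f₁ ⋆ g) (suc n)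
      ≈⟨ +-congˡ (leibniz f₁ g n) ⟩
    f 0 * ∂ g (suc n) + (f 1 * g (suc n) + (f₁ ∘ suc ⋆ g) n) + ((∂ f₁ ⋆ g) n + (f₁ ⋆ ∂ g) n)
      ≈⟨ solve 6 (λ a b c d e h → a :+ (b :* c :+ d) :+ (e :+ h) := (b :* c :+ (d :+ e)) :+ (a :+ h)) refl _ _ _ _ _ _ ⟩
    f 1 * g (suc n) + ((f₁ ∘ suc ⋆ g) n + (∂ f₁ ⋆ g) n) + (f 0 * ∂ g (suc n) + (f₁ ⋆ ∂ g) n)
      ≈⟨ +-congʳ (+-cong (*-congʳ (trans (sym (*-identityˡ _)) (*-congʳ (sym ν1≈1))))
          (sym (⋆-distribʳ (f₁ ∘ suc) (∂ f₁) g n))) ⟩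
    ∂ f 0 * g (suc n) + ((λ i → f₁ (suc i) + ∂ f₁ i) ⋆ g) n + (f 0 * ∂ g (suc n) + (f₁ ⋆ ∂ g) n)
      -- `∂ f₁` weighs f (i + 2) by i + 1 only; the extra copy of `f₁ ⋆ g` split off at the start
      -- supplies the missing one.
      ≈⟨ +-congʳ (+-congˡ (⋆-cong {g = g} (λ i → solve 2 (λ m a → a :+ m :* a := (con (+ 1) :+ m) :* a) refl
          (ν (suc i)) (f₁ (suc i))) (λ _ → refl) n)) ⟩
    ∂ f 0 * g (suc n) + ((∂ f ∘ suc) ⋆ g) n + (f 0 * ∂ g (suc n) + (f₁ ⋆ ∂ g) n) ∎
    where
    f₁ : ℕ → Carrier
    f₁ = f ∘ suc

  -- Taking partial sums multiplies a power series by x / (1 - x), so this is an instance of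
  -- associativity of the Cauchy product.
  Σ<-⋆ : ∀ f g → Σ< (f ⋆ g) ≋ f ⋆ Σ< g
  Σ<-⋆ f g zero    = solve 1 (λ a → con (+ 0) := a :* con (+ 0) :+ con (+ 0)) refl (f 0)
  Σ<-⋆ f g (suc n) = begin
    f 0 * g 0 + 0# + Σ< (λ k → f 0 * g (suc k) + (f ∘ suc ⋆ g) k) n
      ≈⟨ +-congˡ (trans (Σ<-+ (scale (f 0) (g ∘ suc)) (f ∘ suc ⋆ g) n)
          (+-cong (Σ<-scale (f 0) (g ∘ suc) n) (Σ<-⋆ (f ∘ suc) g n))) ⟩
    f 0 * g 0 + 0# + (f 0 * Σ< (g ∘ suc) n + (f ∘ suc ⋆ Σ< g) n)
      ≈⟨ solve 4 (λ a b c d → a :* b :+ con (+ 0) :+ (a :* c :+ d) := a :* (b :+ c) :+ d) refl _ _ _ _ ⟩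
    f 0 * (g 0 + Σ< (g ∘ suc) n) + (f ∘ suc ⋆ Σ< g) n ∎

  -- The exponential series is its own derivative. Only n! · (1/n!) = 1 enters, so the rational and
  -- the real series are both covered.
  ∂-inverse-factorial : ∀ {1/!} → (∀ n → ν (n !) * 1/! n ≈ 1#) → ∂ 1/! ≋ 1/!
  ∂-inverse-factorial {1/!} !*1/! n = begin
    ν (suc n) * 1/! (suc n)                       ≈⟨ *-identityʳ _ ⟨
    ν (suc n) * 1/! (suc n) * 1#                  ≈⟨ *-congˡ (!*1/! n) ⟨
    ν (suc n) * 1/! (suc n) * (ν (n !) * 1/! n)   ≈⟨ solve 4 (λ a b c d → a :* b :* (c :* d) := a :* c :* b :* d)
        refl (ν (suc n)) (1/! (suc n)) (ν (n !)) (1/! n) ⟩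
    ν (suc n) * ν (n !) * 1/! (suc n) * 1/! n     ≈⟨ *-congʳ (*-congʳ (ν-* (suc n) (n !))) ⟨
    ν (suc n !) * 1/! (suc n) * 1/! n             ≈⟨ *-congʳ (!*1/! (suc n)) ⟩
    1# * 1/! n                                    ≈⟨ *-identityˡ _ ⟩
    1/! n                                         ∎

-- Total positivity of order two for tridiagonal recursions

module TotalPositivity where
  open import Data.Nat.Base using (_+_; _*_; _≤_; z≤n; s≤s)
  open ℕ.≤-Reasoning
  open +-*-Solver

  -- All 2×2 minors of the two-row matrix (x ; y) are nonnegative.
  TP₂ : (x y : ℕ → ℕ) → Set
  TP₂ x y = ∀ {p q} → p ≤ q → x q * y p ≤ x p * y q

  -- Adds a zero column on the left, so that column 0 has a left neighbour like every other column.
  pad : (ℕ → ℕ) → ℕ → ℕ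
  pad x zero    = 0
  pad x (suc k) = x k

  pad-TP₂ : ∀ {x y} → TP₂ x y → TP₂ (pad x) (pad y)
  pad-TP₂ {x} tp {zero}  {q}     _         = ℕ.≤-reflexive (ℕ.*-zeroʳ (pad x q))
  pad-TP₂     tp {suc p} {suc q} (s≤s p≤q) = tp p≤q

  -- A minor is linear in each column, so it stays nonnegative when one column is replaced by a
  -- nonnegative combination of columns.
  combine : ∀ a b c w z x₀ x₁ x₂ y₀ y₁ y₂ →
    w * y₀ ≤ x₀ * z → w * y₁ ≤ x₁ * z → w * y₂ ≤ x₂ * z →
    w * (a * y₀ + b * y₁ + c * y₂) ≤ (a * x₀ + b * x₁ + c * x₂) * z
  combine a b c w z x₀ x₁ x₂ y₀ y₁ y₂ h₀ h₁ h₂ = begin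
    w * (a * y₀ + b * y₁ + c * y₂)
      ≡⟨ solve 7 (λ a b c w y₀ y₁ y₂ → w :* (a :* y₀ :+ b :* y₁ :+ c :* y₂)
           := a :* (w :* y₀) :+ b :* (w :* y₁) :+ c :* (w :* y₂)) ≡.refl a b c w y₀ y₁ y₂ ⟩
    a * (w * y₀) + b * (w * y₁) + c * (w * y₂)
      ≤⟨ ℕ.+-mono-≤ (ℕ.+-mono-≤ (ℕ.*-monoʳ-≤ a h₀) (ℕ.*-monoʳ-≤ b h₁)) (ℕ.*-monoʳ-≤ c h₂) ⟩
    a * (x₀ * z) + b * (x₁ * z) + c * (x₂ * z)
      ≡⟨ solve 7 (λ a b c z x₀ x₁ x₂ → a :* (x₀ :* z) :+ b :* (x₁ :* z) :+ c :* (x₂ :* z)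
           := (a :* x₀ :+ b :* x₁ :+ c :* x₂) :* z) ≡.refl a b c z x₀ x₁ x₂ ⟩
    (a * x₀ + b * x₁ + c * x₂) * z ∎

  -- Cauchy–Binet for the rows (a b c 0) and (0 a′ b′ c′): the only product of
  -- minors with a negative factor is absorbed by b b′ = c a′ + d.
  adjacent-minor : ∀ a b c a′ b′ c′ d x₀ x₁ x₂ x₃ y₀ y₁ y₂ y₃ → b * b′ ≡ c * a′ + d →
    x₁ * y₀ ≤ x₀ * y₁ → x₂ * y₀ ≤ x₀ * y₂ → x₃ * y₀ ≤ x₀ * y₃ →
    x₂ * y₁ ≤ x₁ * y₂ → x₃ * y₁ ≤ x₁ * y₃ → x₃ * y₂ ≤ x₂ * y₃ →
    (a′ * x₁ + b′ * x₂ + c′ * x₃) * (a * y₀ + b * y₁ + c * y₂) ≤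
    (a * x₀ + b * x₁ + c * x₂) * (a′ * y₁ + b′ * y₂ + c′ * y₃)
  adjacent-minor a b c a′ b′ c′ d x₀ x₁ x₂ x₃ y₀ y₁ y₂ y₃ bb′ h₀₁ h₀₂ h₀₃ h₁₂ h₁₃ h₂₃ = begin
    (a′ * x₁ + b′ * x₂ + c′ * x₃) * (a * y₀ + b * y₁ + c * y₂)
      ≡⟨ solve 12 (λ a b c a′ b′ c′ x₁ x₂ x₃ y₀ y₁ y₂ →
           (a′ :* x₁ :+ b′ :* x₂ :+ c′ :* x₃) :* (a :* y₀ :+ b :* y₁ :+ c :* y₂) :=
           b :* a′ :* (x₁ :* y₁) :+ c :* b′ :* (x₂ :* y₂) :+ c :* a′ :* (x₁ :* y₂) :+ (b :* b′) :* (x₂ :* y₁)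
           :+ a :* a′ :* (x₁ :* y₀) :+ a :* b′ :* (x₂ :* y₀) :+ a :* c′ :* (x₃ :* y₀) :+ b :* c′ :* (x₃ :* y₁) :+ c
               :* c′ :* (x₃ :* y₂))
           ≡.refl a b c a′ b′ c′ x₁ x₂ x₃ y₀ y₁ y₂ ⟩
    common + c * a′ * (x₁ * y₂) + (b * b′) * (x₂ * y₁)
      + a * a′ * (x₁ * y₀) + a * b′ * (x₂ * y₀) + a * c′ * (x₃ * y₀) + b * c′ * (x₃ * y₁) + c * c′ * (x₃ * y₂)
      ≤⟨ +-mono-≤ (+-mono-≤ (+-mono-≤ (+-mono-≤ (+-mono-≤ middle
           (*-monoʳ-≤ (a * a′) h₀₁)) (*-monoʳ-≤ (a * b′) h₀₂)) (*-monoʳ-≤ (a * c′) h₀₃)) (*-monoʳ-≤ (b * c′) h₁₃))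
               (*-monoʳ-≤ (c * c′) h₂₃) ⟩
    common + c * a′ * (x₂ * y₁) + (b * b′) * (x₁ * y₂)
      + a * a′ * (x₀ * y₁) + a * b′ * (x₀ * y₂) + a * c′ * (x₀ * y₃) + b * c′ * (x₁ * y₃) + c * c′ * (x₂ * y₃)
      ≡⟨ solve 12 (λ a b c a′ b′ c′ x₀ x₁ x₂ y₁ y₂ y₃ →
           b :* a′ :* (x₁ :* y₁) :+ c :* b′ :* (x₂ :* y₂) :+ c :* a′ :* (x₂ :* y₁) :+ (b :* b′) :* (x₁ :* y₂)
           :+ a :* a′ :* (x₀ :* y₁) :+ a :* b′ :* (x₀ :* y₂) :+ a :* c′ :* (x₀ :* y₃) :+ b :* c′ :* (x₁ :* y₃) :+ c
               :* c′ :* (x₂ :* y₃)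
           := (a :* x₀ :+ b :* x₁ :+ c :* x₂) :* (a′ :* y₁ :+ b′ :* y₂ :+ c′ :* y₃))
           ≡.refl a b c a′ b′ c′ x₀ x₁ x₂ y₁ y₂ y₃ ⟩
    (a * x₀ + b * x₁ + c * x₂) * (a′ * y₁ + b′ * y₂ + c′ * y₃) ∎
    where
    open import Data.Nat.Properties using (+-mono-≤; *-monoʳ-≤)

    -- The products with equal column indices, which occur on both sides.
    common = b * a′ * (x₁ * y₁) + c * b′ * (x₂ * y₂)

    swap : ∀ e m m′ → e + c * a′ * m + (c * a′ + d) * m′ ≡ e + c * a′ * m′ + c * a′ * m + d * m′
    swap = solve 6 (λ c a′ d e m m′ → e :+ c :* a′ :* m :+ (c :* a′ :+ d) :* m′
                   := e :+ c :* a′ :* m′ :+ c :* a′ :* m :+ d :* m′) ≡.refl c a′ d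

    middle : common + c * a′ * (x₁ * y₂) + (b * b′) * (x₂ * y₁) ≤ common + c * a′ * (x₂ * y₁) + (b * b′) * (x₁ * y₂)
    middle = begin
      common + c * a′ * (x₁ * y₂) + (b * b′) * (x₂ * y₁)                    ≡⟨ ≡.cong
          (λ h → common + c * a′ * (x₁ * y₂) + h * (x₂ * y₁)) bb′ ⟩
      common + c * a′ * (x₁ * y₂) + (c * a′ + d) * (x₂ * y₁)                ≡⟨ swap common (x₁ * y₂) (x₂ * y₁) ⟩
      common + c * a′ * (x₂ * y₁) + c * a′ * (x₁ * y₂) + d * (x₂ * y₁)      ≤⟨ ℕ.+-monoʳ-≤ _ (*-monoʳ-≤ d h₁₂) ⟩
      common + c * a′ * (x₂ * y₁) + c * a′ * (x₁ * y₂) + d * (x₁ * y₂)      ≡⟨ solve 6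
          (λ c a′ d e m m′ → e :+ c :* a′ :* m′ :+ c :* a′ :* m :+ d :* m := e :+ c :* a′ :* m′ :+ (c :* a′ :+ d) :*
          m) ≡.refl c a′ d common (x₁ * y₂) (x₂ * y₁) ⟩
      common + c * a′ * (x₂ * y₁) + (c * a′ + d) * (x₁ * y₂)                ≡⟨ ≡.cong
          (λ h → common + c * a′ * (x₂ * y₁) + h * (x₁ * y₂)) bb′ ⟨
      common + c * a′ * (x₂ * y₁) + (b * b′) * (x₁ * y₂)                    ∎

  module Tridiagonal (lower diagonal upper : ℕ → ℕ)
                     (minor : ∀ k → upper k * lower (suc k) ≤ diagonal k * diagonal (suc k)) where

    step : (ℕ → ℕ) → ℕ → ℕ
    step x k = lower k * pad x k + diagonal k * x k + upper k * x (suc k)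

    -- If l ≥ k + 2, every column of the window k - 1, k, k + 1 is at most every column of l - 1, l,
    -- l + 1, and bilinearity suffices. For l = k + 1 the windows overlap in two columns, and the
    -- minors of the tridiagonal matrix itself come in.
    step-TP₂ : ∀ {x y} → TP₂ x y → TP₂ (step x) (step y)
    step-TP₂ {x} {y} tp {k} {l} k≤l with ℕ.m≤n⇒m<n∨m≡n k≤l
    ... | inj₂ ≡.refl = ℕ.≤-refl
    ... | inj₁ k<l with ℕ.m≤n⇒m<n∨m≡n k<l
    ...   | inj₂ ≡.refl = adjacent-minor (lower k) (diagonal k) (upper k) (lower l) (diagonal l) (upper l)
              -- The surplus d in b b′ = c a′ + d; the truncated subtraction is exact by `minor`.
              (diagonal k * diagonal l ℕ.∸ upper k * lower l)
              (pad x k) (x k) (x l) (x (suc l)) (pad y k) (y k) (y l) (y (suc l))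
              (≡.sym (ℕ.m+[n∸m]≡n (minor k)))
              (pad-TP₂ tp (ℕ.n≤1+n k)) (pad-TP₂ tp (ℕ.m≤n+m k 2)) (pad-TP₂ tp (ℕ.m≤n+m k 3))
              (tp (ℕ.n≤1+n k)) (tp (ℕ.m≤n+m k 2)) (tp (ℕ.n≤1+n l))
    ...   | inj₁ k+1<l = combine (lower k) (diagonal k) (upper k) (step x l) (step y l)
              (pad x k) (x k) (x (suc k)) (pad y k) (y k) (y (suc k))
              (row (ℕ.≤-trans (ℕ.m≤n+m k 2) k+1<l)) (row (ℕ.≤-trans (ℕ.n≤1+n (suc k)) k+1<l)) (row k+1<l)
      where
      -- Padding shifts indices by one: p ≤ l says that column p - 1 does not come after any of l -
      -- 1, l, l + 1.
      row : ∀ {p} → p ≤ l → step x l * pad y p ≤ pad x p * step y l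
      row {p} p≤l = begin
        step x l * pad y p    ≡⟨ ℕ.*-comm (step x l) (pad y p) ⟩
        pad y p * step x l    ≤⟨ combine (lower l) (diagonal l) (upper l) (pad y p) (pad x p)
                                (pad y l) (y l) (y (suc l)) (pad x l) (x l) (x (suc l)) (flip p≤l)
                                    (flip (ℕ.m≤n⇒m≤1+n p≤l)) (flip (ℕ.m≤n⇒m≤1+n (ℕ.m≤n⇒m≤1+n p≤l))) ⟩
        step y l * pad x p    ≡⟨ ℕ.*-comm (step y l) (pad x p) ⟩
        pad x p * step y l    ∎
        where
        flip : ∀ {q} → p ≤ q → pad y p * pad x q ≤ pad y q * pad x p
        flip {q} p≤q = ≡.subst₂ _≤_ (ℕ.*-comm (pad x q) (pad y p)) (ℕ.*-comm (pad x p) (pad y q)) (pad-TP₂ tp p≤q)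

    initial : ℕ → ℕ
    initial zero    = 1
    initial (suc _) = 0

    rows : ℕ → ℕ → ℕ
    rows zero    = initial
    rows (suc n) = step (rows n)

    initial-TP₂ : ∀ {y} → TP₂ initial y
    initial-TP₂ {y} {p}     {suc q} _ = z≤n
    initial-TP₂ {y} {zero}  {zero}  _ = ℕ.≤-refl

    rows-TP₂ : ∀ n → TP₂ (rows n) (rows (suc n))
    rows-TP₂ zero    = initial-TP₂ {step initial}
    rows-TP₂ (suc n) = step-TP₂ (rows-TP₂ n)

    -- Both sides contain `diagonal 0 * (x 0 * y 0)`; what remains is `upper 0` times the minor of
    -- two consecutive rows in columns 0 and 1.
    column₀-log-convex : ∀ n → rows (suc n) 0 * rows (suc n) 0 ≤ rows n 0 * rows (2 + n) 0
    column₀-log-convex n = begin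
      step x 0 * y 0
        ≡⟨ solve 6 (λ a b c x₀ x₁ y₀ → (a :* con 0 :+ b :* x₀ :+ c :* x₁) :* y₀ := b :* (x₀ :* y₀) :+ c :* (x₁ :* y₀))
             ≡.refl (lower 0) (diagonal 0) (upper 0) (x 0) (x 1) (y 0) ⟩
      diagonal 0 * (x 0 * y 0) + upper 0 * (x 1 * y 0)
        ≤⟨ ℕ.+-monoʳ-≤ _ (ℕ.*-monoʳ-≤ (upper 0) (rows-TP₂ n z≤n)) ⟩
      diagonal 0 * (x 0 * y 0) + upper 0 * (x 0 * y 1)
        ≡⟨ solve 6 (λ a b c x₀ y₀ y₁ → b :* (x₀ :* y₀) :+ c :* (x₀ :* y₁) := x₀ :* (a :* con 0 :+ b :* y₀ :+ c :* y₁))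
             ≡.refl (lower 0) (diagonal 0) (upper 0) (x 0) (y 0) (y 1) ⟩
      x 0 * step y 0 ∎
      where
      x = rows n
      y = rows (suc n)

    column₀-increasing : 1 ≤ diagonal 0 → ∀ n → rows n 0 ≤ rows (suc n) 0
    column₀-increasing 1≤d n = begin
      rows n 0                                       ≡⟨ ℕ.*-identityˡ _ ⟨
      1 * rows n 0                                   ≤⟨ ℕ.*-monoˡ-≤ (rows n 0) 1≤d ⟩
      diagonal 0 * rows n 0                          ≤⟨ ℕ.m≤n+m _ (lower 0 * 0) ⟩
      lower 0 * 0 + diagonal 0 * rows n 0            ≤⟨ ℕ.m≤m+n _ _ ⟩
      rows (suc n) 0                                 ∎

-- Weighted Stirling sums in powers of u - 1

-- Choose j of i elements and mark any one of the i: the mark falls outside the chosen set or inside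
-- it.
k*nCk-recursion : ∀ i j → i ℕ.* (i C j) ≡ suc j ℕ.* (i C suc j) ℕ.+ j ℕ.* (i C j)
k*nCk-recursion zero    zero    = ≡.refl
k*nCk-recursion zero    (suc j) = ≡.cong₂ ℕ._+_ (≡.sym (ℕ.*-zeroʳ j)) (≡.sym (ℕ.*-zeroʳ j))
k*nCk-recursion (suc i) zero    = ≡.trans (ℕ.*-identityʳ (suc i))
  (≡.sym (≡.trans (ℕ.+-identityʳ _) (≡.trans (ℕ.*-identityˡ _) (nC1≡n (suc i)))))
k*nCk-recursion (suc i) (suc j) = begin
  suc i * (suc i C suc j)
    ≡⟨ ≡.cong (suc i *_) (nCk+nC[k+1]≡[n+1]C[k+1] i j) ⟨
  suc i * (i C j + i C suc j)
    ≡⟨ solve 3 (λ i a b → (con 1 :+ i) :* (a :+ b) := a :+ b :+ (i :* a :+ i :* b)) ≡.refl i (i C j) (i C suc j) ⟩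
  i C j + i C suc j + (i * (i C j) + i * (i C suc j))
    ≡⟨ ≡.cong (λ x → i C j + i C suc j + x) (≡.cong₂ _+_ (k*nCk-recursion i j) (k*nCk-recursion i (suc j))) ⟩
  i C j + i C suc j + (suc j * (i C suc j) + j * (i C j) + (suc (suc j) * (i C suc (suc j)) + suc j * (i C suc j)))
    ≡⟨ solve 4 (λ j a b c → a :+ b :+ ((con 1 :+ j) :* b :+ j :* a :+ ((con 2 :+ j) :* c :+ (con 1 :+ j) :* b))
         := (con 2 :+ j) :* (b :+ c) :+ (con 1 :+ j) :* (a :+ b)) ≡.refl j (i C j) (i C suc j) (i C suc (suc j)) ⟩
  suc (suc j) * (i C suc j + i C suc (suc j)) + suc j * (i C j + i C suc j)
    ≡⟨ ≡.cong₂ (λ x y → suc (suc j) * x + suc j * y) (nCk+nC[k+1]≡[n+1]C[k+1] i (suc j)) (nCk+nC[k+1]≡[n+1]C[k+1] i j) ⟩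
  suc (suc j) * (suc i C suc (suc j)) + suc j * (suc i C suc j) ∎
  where
  open import Data.Nat.Base using (_+_; _*_)
  open ≡-Reasoning
  open +-*-Solver

-- s = 0 gives the weights (2k-1)!!, s = 1 the weights (2k)!! of the shifted Stirling numbers S(n+1,k+1).
module WeightedStirling (s : ℕ) (s≤1 : s ℕ.≤ 1) where
  open TotalPositivity using (pad)

  -- With v = u - 1, (g v^k)′ = g (k v^(k-1) + (3k + 1) v^k + (2k + 1) v^(k+1)); with u in place of
  -- g the last coefficient is 2k + 2. All three functions are indexed by the resulting power of v,
  -- hence the shifts in `lower` and `upper`.
  lower diagonal upper : ℕ → ℕ
  lower zero     = 0
  lower (suc k)  = 2 ℕ.* k ℕ.+ 1 ℕ.+ s
  diagonal k     = 3 ℕ.* k ℕ.+ 1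
  upper k        = suc k

  minor : ∀ k → upper k ℕ.* lower (suc k) ℕ.≤ diagonal k ℕ.* diagonal (suc k)
  minor k = ℕ.*-mono-≤
    (≡.subst (ℕ._≤ diagonal k) (ℕ.+-comm k 1) (ℕ.+-monoˡ-≤ 1 (ℕ.m≤n*m k 3)))
    (ℕ.+-mono-≤ (≡.subst (2 ℕ.* k ℕ.+ 1 ℕ.≤_) (≡.sym (ℕ.*-distribˡ-+ 3 1 k))
        (≡.subst (ℕ._≤ 3 ℕ.+ 3 ℕ.* k) (ℕ.+-comm 1 (2 ℕ.* k))
        (ℕ.+-mono-≤ (ℕ.m≤m+n 1 2) (ℕ.*-monoˡ-≤ k (ℕ.m≤m+n 2 1))))) s≤1)

  open TotalPositivity.Tridiagonal lower diagonal upper minor public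

  -- For u′ = 2u² - u and g′ = g u: the differentiation of g p(u) (s = 0) or u p(u) (s = 1), with p expanded in powers of u - 1.
  binomial-step : ∀ i j → (2 ℕ.* i ℕ.+ 1 ℕ.+ s) ℕ.* (suc i C j) ≡ (i ℕ.+ s) ℕ.* (i C j) ℕ.+ step (i C_) j
  binomial-step i zero = begin
    (2 * i + 1 + s) * 1
      ≡⟨ solve 2 (λ i s → (con 2 :* i :+ con 1 :+ s) :* con 1 := (i :+ s) :* con 1 :+ (con 1 :+ con 1 :* i)) ≡.refl i
          s ⟩
    (i + s) * 1 + (1 + 1 * i)
      ≡⟨ ≡.cong (λ x → (i + s) * 1 + (1 + 1 * x)) (nC1≡n i) ⟨
    (i + s) * 1 + step (i C_) 0 ∎
    where
    open import Data.Nat.Base using (_+_; _*_)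
    open ≡-Reasoning
    open +-*-Solver
  binomial-step i (suc j) = begin
    (2 * i + 1 + s) * (suc i C suc j)
      ≡⟨ ≡.cong ((2 * i + 1 + s) *_) (nCk+nC[k+1]≡[n+1]C[k+1] i j) ⟨
    (2 * i + 1 + s) * (a + b)
      ≡⟨ solve 4 (λ i s a b → (con 2 :* i :+ con 1 :+ s) :* (a :+ b)
           := (i :+ s) :* b :+ (b :+ i :* b :+ con 2 :* (i :* a) :+ (con 1 :+ s) :* a)) ≡.refl i s a b ⟩
    (i + s) * b + (b + i * b + 2 * (i * a) + (1 + s) * a)
      ≡⟨ ≡.cong₂ (λ x y → (i + s) * b + (b + x + 2 * y + (1 + s) * a)) (k*nCk-recursion i (suc j))
          (k*nCk-recursion i j) ⟩
    (i + s) * b + (b + (suc (suc j) * d + suc j * b) + 2 * (suc j * b + j * a) + (1 + s) * a)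
      ≡⟨ solve 6 (λ i s j a b d → (i :+ s) :* b :+ (b :+ ((con 2 :+ j) :* d :+ (con 1 :+ j) :* b) :+ con 2 :*
          ((con 1 :+ j) :* b :+ j :* a) :+ (con 1 :+ s) :* a)
           := (i :+ s) :* b :+ ((con 2 :* j :+ con 1 :+ s) :* a :+ (con 3 :* (con 1 :+ j) :+ con 1) :* b :+
               (con 2 :+ j) :* d)) ≡.refl i s j a b d ⟩
    (i + s) * b + step (i C_) (suc j) ∎
    where
    open import Data.Nat.Base using (_+_; _*_)
    open ≡-Reasoning
    open +-*-Solver
    a = i C j
    b = i C suc j
    d = i C suc (suc j)

  module _ {c ℓ} (CR : CommutativeRing c ℓ) where
    open CommutativeRing CR
    open Sequences CR
    open IntegerSolver CR
    open Relation.Binary.Reasoning.Setoid setoid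

    -- `τ n i` is the coefficient of u^i in the polynomial p with n-th derivative g p(u) or u p(u).
    -- The recursion reads off (g u^i)′ = g ((2i + 1) u^(i+1) - i u^i), or (u u^i)′ = u ((2i + 2)
    -- u^(i+1) - (i + 1) u^i).
    record SignedTriangle (τ : ℕ → ℕ → Carrier) : Set ℓ where
      field
        τ₀₀ : τ 0 0 ≈ 1#
        τ₀ₛ : ∀ i → τ 0 (suc i) ≈ 0#
        τₛ₀ : ∀ n → τ (suc n) 0 ≈ - (ν s * τ n 0)
        τₛₛ : ∀ n i → τ (suc n) (suc i) ≈ ν (2 ℕ.* i ℕ.+ 1 ℕ.+ s) * τ n i - ν (suc i ℕ.+ s) * τ n (suc i)

      τ-outside : ∀ n {i} → n ℕ.< i → τ n i ≈ 0#
      τ-outside zero    {suc i} _           = τ₀ₛ i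
      τ-outside (suc n) {suc i} (ℕ.s≤s n<i) = begin
        τ (suc n) (suc i)     ≈⟨ τₛₛ n i ⟩
        ν (2 ℕ.* i ℕ.+ 1 ℕ.+ s) * τ n i - ν (suc i ℕ.+ s) * τ n (suc i)
          ≈⟨ +-cong (*-congˡ (τ-outside n n<i)) (-‿cong (*-congˡ (τ-outside n (ℕ.m≤n⇒m≤1+n n<i)))) ⟩
        ν (2 ℕ.* i ℕ.+ 1 ℕ.+ s) * 0# - ν (suc i ℕ.+ s) * 0#
          ≈⟨ solve 2 (λ a b → a :* con (+ 0) :- b :* con (+ 0) := con (+ 0)) refl _ _ ⟩
        0# ∎

      rowSum : ℕ → (ℕ → Carrier) → Carrier
      rowSum n φ = Σ< (λ i → τ n i * φ i) (suc n)

      rowSum-cong : ∀ n {φ ψ} → φ ≋ ψ → rowSum n φ ≈ rowSum n ψ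
      rowSum-cong n φ≋ψ = Σ<-cong (λ i → *-congˡ {τ n i} (φ≋ψ i)) (suc n)

      rowSum-+ : ∀ n φ ψ → rowSum n (λ i → φ i + ψ i) ≈ rowSum n φ + rowSum n ψ
      rowSum-+ n φ ψ = trans (Σ<-cong (λ i → distribˡ (τ n i) (φ i) (ψ i)) (suc n))
          (Σ<-+ (λ i → τ n i * φ i) (λ i → τ n i * ψ i) (suc n))

      rowSum-scale : ∀ n a φ → rowSum n (scale a φ) ≈ a * rowSum n φ
      rowSum-scale n a φ = trans (Σ<-cong (λ i → solve 3 (λ t a p → t :* (a :* p) := a :* (t :* p)) refl (τ n i) a
          (φ i)) (suc n)) (Σ<-scale a (λ i → τ n i * φ i) (suc n))

      -- `φ` acts as the linear functional u^i ↦ φ i on polynomials. The recursion is transposed: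
      -- rather than differentiating the polynomial, the functional is pulled back along u^i ↦ (2i +
      -- 1 + s) u^(i+1) - (i + s) u^i.
      rowSum-suc : ∀ n φ → rowSum (suc n) φ ≈ rowSum n (λ i → ν (2 ℕ.* i ℕ.+ 1 ℕ.+ s) * φ (suc i) - ν (i ℕ.+ s) * φ i)
      rowSum-suc n φ = begin
        τ (suc n) 0 * φ 0 + Σ< (λ i → τ (suc n) (suc i) * φ (suc i)) (suc n)
          ≈⟨ +-cong (trans (*-congʳ (τₛ₀ n)) (solve 3 (λ a b c → (:- (a :* b)) :* c := :- (b :* (a :* c))) refl _ _ _))
               (Σ<-cong (λ i → trans (*-congʳ (τₛₛ n i))
                   (solve 5 (λ b t a t′ p → (b :* t :- a :* t′) :* p := t :* (b :* p) :+ con -[1+ 0 ] :*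
                   (t′ :* (a :* p))) refl (ν (2 ℕ.* i ℕ.+ 1 ℕ.+ s)) (τ n i) _ _ (φ (suc i)))) (suc n)) ⟩
        - f 0 + Σ< (λ i → g i + scale (- 1#) (f ∘ suc) i) (suc n)
          ≈⟨ +-congˡ (trans (Σ<-+ g (scale (- 1#) (f ∘ suc)) (suc n)) (+-congˡ (Σ<-scale (- 1#) (f ∘ suc) (suc n)))) ⟩
        - f 0 + (Σ< g (suc n) + - 1# * Σ< (f ∘ suc) (suc n))
          ≈⟨ solve 3 (λ a b c → :- a :+ (b :+ con -[1+ 0 ] :* c) := b :+ con -[1+ 0 ] :* (a :+ c)) refl _ _ _ ⟩
        Σ< g (suc n) + - 1# * Σ< f (2 ℕ.+ n)
          -- The summand with index n + 1 lies outside the triangle.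
          ≈⟨ +-congˡ (*-congˡ (trans (Σ<-last f (suc n))
              (trans (+-congˡ (trans (*-congʳ (τ-outside n ℕ.≤-refl)) (zeroˡ _))) (+-identityʳ _)))) ⟩
        Σ< g (suc n) + - 1# * Σ< f (suc n)
          ≈⟨ trans (+-congˡ (sym (Σ<-scale (- 1#) f (suc n)))) (sym (Σ<-+ g (scale (- 1#) f) (suc n))) ⟩
        Σ< (λ i → g i + scale (- 1#) f i) (suc n)
          ≈⟨ Σ<-cong (λ i → solve 3 (λ t x y → t :* x :+ con -[1+ 0 ] :* (t :* y) := t :* (x :- y)) refl (τ n i)
               (ν (2 ℕ.* i ℕ.+ 1 ℕ.+ s) * φ (suc i)) (ν (i ℕ.+ s) * φ i)) (suc n) ⟩
        rowSum n (λ i → ν (2 ℕ.* i ℕ.+ 1 ℕ.+ s) * φ (suc i) - ν (i ℕ.+ s) * φ i) ∎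
        where
        f g : ℕ → Carrier
        f i = τ n i * (ν (i ℕ.+ s) * φ i)
        g i = τ n i * (ν (2 ℕ.* i ℕ.+ 1 ℕ.+ s) * φ (suc i))

      -- By u^i = Σ C(i,j) (u - 1)^j, the functional i ↦ C(i,j) extracts the coefficient of (u -
      -- 1)^j. At j = 0 this is the value at u = 1.
      rowSum-binomial : ∀ n j → rowSum n (λ i → ν (i C j)) ≈ ν (rows n j)
      rowSum-binomial-pad : ∀ n j → rowSum n (λ i → ν (pad (i C_) j)) ≈ ν (pad (rows n) j)

      rowSum-binomial zero zero = begin
        τ 0 0 * ν 1 + 0#   ≈⟨ +-identityʳ _ ⟩
        τ 0 0 * ν 1        ≈⟨ *-congʳ τ₀₀ ⟩
        1# * ν 1           ≈⟨ *-identityˡ _ ⟩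
        ν 1                ∎
      rowSum-binomial zero (suc j) = trans (+-identityʳ _) (zeroʳ _)
      rowSum-binomial (suc n) j = begin
        rowSum (suc n) (λ i → ν (i C j))
          ≈⟨ rowSum-suc n (λ i → ν (i C j)) ⟩
        rowSum n (λ i → ν (2 ℕ.* i ℕ.+ 1 ℕ.+ s) * ν (suc i C j) - ν (i ℕ.+ s) * ν (i C j))
          ≈⟨ rowSum-cong n difference ⟩
        rowSum n (λ i → a * ν (pad (i C_) j) + b * ν (i C j) + d * ν (i C suc j))
          ≈⟨ trans (rowSum-+ n (λ i → a * ν (pad (i C_) j) + b * ν (i C j)) (scale d (λ i → ν (i C suc j))))
               (+-congʳ (rowSum-+ n (scale a (λ i → ν (pad (i C_) j))) (scale b (λ i → ν (i C j))))) ⟩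
        rowSum n (scale a λ i → ν (pad (i C_) j)) + rowSum n (scale b λ i → ν (i C j)) + rowSum n
            (scale d λ i → ν (i C suc j))
          ≈⟨ +-cong (+-cong (rowSum-scale n a (λ i → ν (pad (i C_) j))) (rowSum-scale n b (λ i → ν (i C j))))
              (rowSum-scale n d (λ i → ν (i C suc j))) ⟩
        a * rowSum n (λ i → ν (pad (i C_) j)) + b * rowSum n (λ i → ν (i C j)) + d * rowSum n (λ i → ν (i C suc j))
          ≈⟨ +-cong (+-cong (*-congˡ (rowSum-binomial-pad n j)) (*-congˡ (rowSum-binomial n j)))
              (*-congˡ (rowSum-binomial n (suc j))) ⟩
        a * ν (pad (rows n) j) + b * ν (rows n j) + d * ν (rows n (suc j))
          ≈⟨ ν-step (rows n) ⟨
        ν (rows (suc n) j) ∎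
        where
        a = ν (lower j)
        b = ν (diagonal j)
        d = ν (upper j)

        ν-step : ∀ x → ν (step x j) ≈ a * ν (pad x j) + b * ν (x j) + d * ν (x (suc j))
        ν-step x = trans (ν-+ (lower j ℕ.* pad x j ℕ.+ diagonal j ℕ.* x j) (upper j ℕ.* x (suc j)))
          (+-cong (trans (ν-+ (lower j ℕ.* pad x j) (diagonal j ℕ.* x j))
              (+-cong (ν-* (lower j) (pad x j)) (ν-* (diagonal j) (x j))))
                  (ν-* (upper j) (x (suc j))))

        difference : ∀ i → ν (2 ℕ.* i ℕ.+ 1 ℕ.+ s) * ν (suc i C j) - ν (i ℕ.+ s) * ν (i C j)
                     ≈ a * ν (pad (i C_) j) + b * ν (i C j) + d * ν (i C suc j)
        difference i = begin
          ν (2 ℕ.* i ℕ.+ 1 ℕ.+ s) * ν (suc i C j) - ν (i ℕ.+ s) * ν (i C j)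
            ≈⟨ +-congʳ (ν-* (2 ℕ.* i ℕ.+ 1 ℕ.+ s) _) ⟨
          ν ((2 ℕ.* i ℕ.+ 1 ℕ.+ s) ℕ.* (suc i C j)) - ν (i ℕ.+ s) * ν (i C j)
            ≡⟨ ≡.cong (λ k → ν k - ν (i ℕ.+ s) * ν (i C j)) (binomial-step i j) ⟩
          ν ((i ℕ.+ s) ℕ.* (i C j) ℕ.+ step (i C_) j) - ν (i ℕ.+ s) * ν (i C j)
            ≈⟨ +-congʳ (trans (ν-+ ((i ℕ.+ s) ℕ.* (i C j)) _) (+-cong (ν-* (i ℕ.+ s) _) (ν-step (i C_)))) ⟩
          ν (i ℕ.+ s) * ν (i C j) + (a * ν (pad (i C_) j) + b * ν (i C j) + d * ν (i C suc j)) - ν (i ℕ.+ s) * ν (i C j)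
            ≈⟨ solve 2 (λ x y → x :+ y :- x := y) refl _ _ ⟩
          a * ν (pad (i C_) j) + b * ν (i C j) + d * ν (i C suc j) ∎

      rowSum-binomial-pad n zero    = trans (Σ<-cong (λ i → trans (zeroʳ (τ n i)) (sym (zeroˡ 0#))) (suc n))
                                  (trans (Σ<-scale 0# (λ _ → 0#) (suc n)) (zeroˡ _))
      rowSum-binomial-pad n (suc j) = rowSum-binomial n j

      Σ-row : ∀ n → Σ< (τ n) (suc n) ≈ ν (rows n 0)
      Σ-row n = trans (Σ<-cong (λ i → sym (trans (*-congˡ ν1≈1) (*-identityʳ (τ n i)))) (suc n)) (rowSum-binomial n 0)

-- Stirling numbers from their generating function

module StirlingSeries {c ℓ} (CR : CommutativeRing c ℓ) where
  open CommutativeRing CR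
  open Sequences CR
  open IntegerSolver CR
  open Relation.Binary.Reasoning.Setoid setoid

  record Stirling (δ e 1/! : ℕ → Carrier) (p : ℕ → ℕ → Carrier) : Set ℓ where
    field
      δ₀  : δ 0 ≈ 1#
      δₛ  : ∀ n → δ (suc n) ≈ 0#
      !*1/! : ∀ n → ν (n !) * 1/! n ≈ 1#
      e≈  : ∀ n → e n ≈ 1/! n - δ n
      p₀  : p 0 ≋ δ
      pₛ  : ∀ k → p (suc k) ≋ e ⋆ p k

    ∂-1/! : ∂ 1/! ≋ 1/!
    ∂-1/! = ∂-inverse-factorial !*1/!

    ∂δ : ∂ δ ≋ λ _ → 0#
    ∂δ n = trans (*-congˡ (δₛ n)) (zeroʳ _)

    ∂e : ∂ e ≋ λ n → e n + δ n
    ∂e n = begin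
      ν (suc n) * e (suc n)                       ≈⟨ *-congˡ (trans (e≈ (suc n)) (+-congˡ (-‿cong (δₛ n)))) ⟩
      ν (suc n) * (1/! (suc n) - 0#)              ≈⟨ *-congˡ (solve 1 (λ x → x :- con (+ 0) := x) refl (1/! (suc n))) ⟩
      ν (suc n) * 1/! (suc n)                     ≈⟨ ∂-1/! n ⟩
      1/! n                                       ≈⟨ solve 2 (λ x y → x := x :- y :+ y) refl (1/! n) (δ n) ⟩
      1/! n - δ n + δ n                           ≈⟨ +-congʳ (e≈ n) ⟨
      e n + δ n                                   ∎

    e₀ : e 0 ≈ 0#
    e₀ = begin
      e 0                  ≈⟨ e≈ 0 ⟩
      1/! 0 - δ 0          ≈⟨ +-cong (trans (sym (*-identityˡ _)) (trans (*-congʳ (sym ν1≈1)) (!*1/! 0))) (-‿cong δ₀) ⟩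
      1# - 1#              ≈⟨ -‿inverseʳ 1# ⟩
      0#                   ∎

    zero-⋆ : ∀ g → (λ _ → 0#) ⋆ g ≋ λ _ → 0#
    zero-⋆ g n = trans (⋆-cong {g = g} (λ _ → sym (zeroˡ 0#)) (λ _ → refl) n)
        (trans (scale-⋆ 0# (λ _ → 0#) g n) (zeroˡ _))

    ⋆-zero : ∀ f → f ⋆ (λ _ → 0#) ≋ λ _ → 0#
    ⋆-zero f n = trans (⋆-cong {f} (λ _ → refl) (λ _ → sym (zeroˡ 0#)) n) (trans (⋆-scale 0# f (λ _ → 0#) n) (zeroˡ _))

    δ-⋆ : ∀ g → δ ⋆ g ≋ g
    δ-⋆ g zero    = trans (+-identityʳ _) (trans (*-congʳ δ₀) (*-identityˡ _))
    δ-⋆ g (suc n) = trans (+-cong (trans (*-congʳ δ₀) (*-identityˡ _))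
      (trans (⋆-cong {g = g} δₛ (λ _ → refl) n) (zero-⋆ g n))) (+-identityʳ _)

    -- Since e′ = e + 1, both are forms of (e^k)′ = k e^(k-1) e′. Proving them together requires
    -- only the product rule and linearity, not associativity of `⋆`.
    e⋆∂p : ∀ k → e ⋆ ∂ (p k) ≋ scale (ν k) (λ n → p (suc k) n + p k n)
    ∂p   : ∀ k → ∂ (p (suc k)) ≋ scale (ν (suc k)) (λ n → p (suc k) n + p k n)

    e⋆∂p zero    n = trans (⋆-cong {e} (λ _ → refl) (λ m → trans (*-congˡ (p₀ (suc m))) (∂δ m)) n)
        (trans (⋆-zero e n) (sym (zeroˡ _)))
    e⋆∂p (suc k) n = begin
      (e ⋆ ∂ (p (suc k))) n
        ≈⟨ ⋆-cong {e} (λ _ → refl) (∂p k) n ⟩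
      (e ⋆ scale (ν (suc k)) (λ m → p (suc k) m + p k m)) n
        ≈⟨ ⋆-scale (ν (suc k)) e (λ m → p (suc k) m + p k m) n ⟩
      ν (suc k) * (e ⋆ (λ m → p (suc k) m + p k m)) n
        ≈⟨ *-congˡ (⋆-distribˡ e (p (suc k)) (p k) n) ⟩
      ν (suc k) * ((e ⋆ p (suc k)) n + (e ⋆ p k) n)
        ≈⟨ *-congˡ (+-cong (pₛ (suc k) n) (pₛ k n)) ⟨
      ν (suc k) * (p (suc (suc k)) n + p (suc k) n) ∎

    ∂p k n = begin
      ν (suc n) * p (suc k) (suc n)
        ≈⟨ *-congˡ (pₛ k (suc n)) ⟩
      ∂ (e ⋆ p k) n
        ≈⟨ leibniz e (p k) n ⟩
      (∂ e ⋆ p k) n + (e ⋆ ∂ (p k)) n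
        ≈⟨ +-cong (trans (⋆-cong {g = p k} ∂e (λ _ → refl) n) (⋆-distribʳ e δ (p k) n)) (e⋆∂p k n) ⟩
      (e ⋆ p k) n + (δ ⋆ p k) n + ν k * (p (suc k) n + p k n)
        ≈⟨ +-congʳ (+-cong (sym (pₛ k n)) (δ-⋆ (p k) n)) ⟩
      p (suc k) n + p k n + ν k * (p (suc k) n + p k n)
        ≈⟨ solve 2 (λ x m → x :+ m :* x := (con (+ 1) :+ m) :* x) refl _ _ ⟩
      ν (suc k) * (p (suc k) n + p k n) ∎

    S₂ : ℕ → ℕ → Carrier
    S₂ n k = ν (n !) * (p k n * 1/! k)

    S₀₀ : S₂ 0 0 ≈ 1#
    S₀₀ = trans (*-congˡ (trans (*-congʳ (trans (p₀ 0) δ₀)) (*-identityˡ _))) (!*1/! 0)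

    S₀ₛ : ∀ k → S₂ 0 (suc k) ≈ 0#
    S₀ₛ k = begin
      ν 1 * (p (suc k) 0 * 1/! (suc k))              ≈⟨ *-congˡ (*-congʳ (trans (pₛ k 0) (+-congʳ (*-congʳ e₀)))) ⟩
      ν 1 * ((0# * p k 0 + 0#) * 1/! (suc k))        ≈⟨ solve 3
          (λ a b c → a :* ((con (+ 0) :* b :+ con (+ 0)) :* c) := con (+ 0)) refl (ν 1) (p k 0) (1/! (suc k)) ⟩
      0#                                             ∎

    Sₛ₀ : ∀ n → S₂ (suc n) 0 ≈ 0#
    Sₛ₀ n = trans (*-congˡ (trans (*-congʳ (trans (p₀ (suc n)) (δₛ n))) (zeroˡ _))) (zeroʳ _)

    -- Compare coefficients in the derivative of (e^x - 1)^(k+1) / (k+1)!, which is (k + 1) (e^x -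
    -- 1)^(k+1) / (k+1)! + (e^x - 1)^k / k!.
    Sₛₛ : ∀ n k → S₂ (suc n) (suc k) ≈ ν (suc k) * S₂ n (suc k) + S₂ n k
    Sₛₛ n k = begin
      ν (suc n !) * (p (suc k) (suc n) * 1/! (suc k))
        ≈⟨ *-congʳ (ν-* (suc n) (n !)) ⟩
      ν (suc n) * ν (n !) * (p (suc k) (suc n) * 1/! (suc k))
        ≈⟨ solve 4 (λ a b c d → a :* b :* (c :* d) := b :* (a :* c :* d)) refl (ν (suc n)) (ν (n !))
            (p (suc k) (suc n)) (1/! (suc k)) ⟩
      ν (n !) * (∂ (p (suc k)) n * 1/! (suc k))
        ≈⟨ *-congˡ (*-congʳ (∂p k n)) ⟩
      ν (n !) * (ν (suc k) * (p (suc k) n + p k n) * 1/! (suc k))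
        ≈⟨ solve 5 (λ f m x y i → f :* (m :* (x :+ y) :* i) := m :* (f :* (x :* i)) :+ f :* (y :* (m :* i))) refl
            (ν (n !)) (ν (suc k)) (p (suc k) n) (p k n) (1/! (suc k)) ⟩
      ν (suc k) * S₂ n (suc k) + ν (n !) * (p k n * ∂ 1/! k)
        ≈⟨ +-congˡ (*-congˡ (*-congˡ (∂-1/! k))) ⟩
      ν (suc k) * S₂ n (suc k) + S₂ n k ∎

    module _ (σ : ℕ → Carrier) (σ₀ : σ 0 ≈ 1#) (σₛ : ∀ n → σ (suc n) ≈ - 1# * σ n)
             (b : ℕ → Carrier) (b₀ : b 0 ≈ 1#) where

      oddTerm : ℕ → ℕ → Carrier
      oddTerm n i = σ n * (σ i * S₂ n i * b i)

      -- The sign (-1)^(n+i) is kept when both indices grow and flips when only n does, which makes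
      -- one term of the Stirling recursion negative. The factor 2i + 1 comes from the weight.
      oddTriangle : (∀ k → b (suc k) ≈ ν (2 ℕ.* k ℕ.+ 1) * b k) →
                    WeightedStirling.SignedTriangle 0 ℕ.z≤n CR oddTerm
      oddTriangle bₛ = record
        { τ₀₀ = trans (*-cong σ₀ (*-cong (*-cong σ₀ S₀₀) b₀))
            (solve 0 (con (+ 1) :* (con (+ 1) :* con (+ 1) :* con (+ 1)) := con (+ 1)) refl)
        ; τ₀ₛ = λ i → trans (*-congˡ (*-congʳ (*-congˡ (S₀ₛ i)))) (kill (σ 0) (σ (suc i)) (b (suc i)))
        ; τₛ₀ = λ n → trans (*-congˡ (*-congʳ (*-congˡ (Sₛ₀ n))))
            (trans (kill (σ (suc n)) (σ 0) (b 0)) (solve 1 (λ x → con (+ 0) := :- (con (+ 0) :* x)) refl (oddTerm n 0)))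
        ; τₛₛ = λ n i → begin
            σ (suc n) * (σ (suc i) * S₂ (suc n) (suc i) * b (suc i))
              ≈⟨ *-cong (σₛ n) (*-cong (*-cong (σₛ i) (Sₛₛ n i)) (bₛ i)) ⟩
            - 1# * σ n * (- 1# * σ i * (ν (suc i) * S₂ n (suc i) + S₂ n i) * (ν (2 ℕ.* i ℕ.+ 1) * b i))
              ≈⟨ solve 7 (λ σn σi m s₁ s₀ w b → con -[1+ 0 ] :* σn :*
                  (con -[1+ 0 ] :* σi :* (m :* s₁ :+ s₀) :* (w :* b))
                   := w :* (σn :* (σi :* s₀ :* b)) :- m :* (σn :* (con -[1+ 0 ] :* σi :* s₁ :* (w :* b)))) refl
                   (σ n) (σ i) (ν (suc i)) (S₂ n (suc i)) (S₂ n i) (ν (2 ℕ.* i ℕ.+ 1)) (b i) ⟩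
            ν (2 ℕ.* i ℕ.+ 1) * oddTerm n i - ν (suc i) *
                (σ n * (- 1# * σ i * S₂ n (suc i) * (ν (2 ℕ.* i ℕ.+ 1) * b i)))
              ≈⟨ +-congˡ (-‿cong (*-congˡ (*-congˡ (*-cong (*-congʳ (σₛ i)) (bₛ i))))) ⟨
            ν (2 ℕ.* i ℕ.+ 1) * oddTerm n i - ν (suc i) * oddTerm n (suc i)
              ≡⟨ ≡.cong₂ (λ h k → ν h * oddTerm n i - ν k * oddTerm n (suc i))
                  (≡.sym (ℕ.+-identityʳ (2 ℕ.* i ℕ.+ 1))) (≡.sym (ℕ.+-identityʳ (suc i))) ⟩
            ν (2 ℕ.* i ℕ.+ 1 ℕ.+ 0) * oddTerm n i - ν (suc i ℕ.+ 0) * oddTerm n (suc i) ∎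
        }
        where
        kill : ∀ x y z → x * (y * 0# * z) ≈ 0#
        kill = solve 3 (λ x y z → x :* (y :* con (+ 0) :* z) := con (+ 0)) refl

      -- Both Stirling indices are shifted by one, so that the triangle starts with S(1,1) = 1
      -- rather than with a column of zeros.
      evenTerm : ℕ → ℕ → Carrier
      evenTerm n i = σ (suc n) * (σ (suc i) * S₂ (suc n) (suc i) * b i)

      evenTriangle : (∀ k → b (suc k) ≈ ν (2 ℕ.* suc k) * b k) →
                     WeightedStirling.SignedTriangle 1 ℕ.≤-refl CR evenTerm
      evenTriangle bₛ = record
        { τ₀₀ = begin
            σ 1 * (σ 1 * S₂ 1 1 * b 0)
              ≈⟨ *-cong σ₁ (*-cong (*-cong σ₁ (trans (Sₛₛ 0 0) (+-cong (*-congˡ (S₀ₛ 0)) S₀₀))) b₀) ⟩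
            - 1# * 1# * (- 1# * 1# * (ν 1 * 0# + 1#) * 1#)
              ≈⟨ solve 1 (λ x → con -[1+ 0 ] :* con (+ 1) :*
                  (con -[1+ 0 ] :* con (+ 1) :* (x :* con (+ 0) :+ con (+ 1)) :* con (+ 1)) := con (+ 1)) refl (ν 1) ⟩
            1# ∎
        ; τ₀ₛ = λ i → begin
            σ 1 * (σ (2 ℕ.+ i) * S₂ 1 (2 ℕ.+ i) * b (suc i))
              ≈⟨ *-congˡ (*-congʳ (*-congˡ (trans (Sₛₛ 0 (suc i)) (+-cong (*-congˡ (S₀ₛ (suc i))) (S₀ₛ i))))) ⟩
            σ 1 * (σ (2 ℕ.+ i) * (ν (2 ℕ.+ i) * 0# + 0#) * b (suc i))
              ≈⟨ solve 4 (λ x y z w → x :* (y :* (z :* con (+ 0) :+ con (+ 0)) :* w) := con (+ 0)) refl (σ 1)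
                  (σ (2 ℕ.+ i)) (ν (2 ℕ.+ i)) (b (suc i)) ⟩
            0# ∎
        ; τₛ₀ = λ n → begin
            σ (2 ℕ.+ n) * (σ 1 * S₂ (2 ℕ.+ n) 1 * b 0)
              ≈⟨ *-cong (σₛ (suc n)) (*-congʳ (*-congˡ (trans (Sₛₛ (suc n) 0) (+-congˡ (Sₛ₀ n))))) ⟩
            - 1# * σ (suc n) * (σ 1 * (ν 1 * S₂ (suc n) 1 + 0#) * b 0)
              ≈⟨ solve 5 (λ x y z w b → con -[1+ 0 ] :* x :* (y :* (z :* w :+ con (+ 0)) :* b) := :-
                  (z :* (x :* (y :* w :* b)))) refl (σ (suc n)) (σ 1) (ν 1) (S₂ (suc n) 1) (b 0) ⟩
            - (ν 1 * evenTerm n 0) ∎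
        ; τₛₛ = λ n i → begin
            σ (2 ℕ.+ n) * (σ (2 ℕ.+ i) * S₂ (2 ℕ.+ n) (2 ℕ.+ i) * b (suc i))
              ≈⟨ *-cong (σₛ (suc n)) (*-cong (*-cong (σₛ (suc i)) (Sₛₛ (suc n) (suc i))) (bₛ i)) ⟩
            - 1# * σ (suc n) * (- 1# * σ (suc i) * (ν (2 ℕ.+ i) * S₂ (suc n) (2 ℕ.+ i) + S₂ (suc n) (suc i)) *
                (ν (2 ℕ.* suc i) * b i))
              ≈⟨ solve 7 (λ σn σi m s₁ s₀ w b → con -[1+ 0 ] :* σn :*
                  (con -[1+ 0 ] :* σi :* (m :* s₁ :+ s₀) :* (w :* b))
                   := w :* (σn :* (σi :* s₀ :* b)) :- m :* (σn :* (con -[1+ 0 ] :* σi :* s₁ :* (w :* b)))) refl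
                   (σ (suc n)) (σ (suc i)) (ν (2 ℕ.+ i)) (S₂ (suc n) (2 ℕ.+ i)) (S₂ (suc n) (suc i))
                       (ν (2 ℕ.* suc i)) (b i) ⟩
            ν (2 ℕ.* suc i) * evenTerm n i - ν (2 ℕ.+ i) *
                (σ (suc n) * (- 1# * σ (suc i) * S₂ (suc n) (2 ℕ.+ i) * (ν (2 ℕ.* suc i) * b i)))
              ≈⟨ +-congˡ (-‿cong (*-congˡ (*-congˡ (*-cong (*-congʳ (σₛ (suc i))) (bₛ i))))) ⟨
            ν (2 ℕ.* suc i) * evenTerm n i - ν (2 ℕ.+ i) * evenTerm n (suc i)
              ≡⟨ ≡.cong₂ (λ h k → ν h * evenTerm n i - ν k * evenTerm n (suc i)) (double i) (ℕ.+-comm 1 (suc i)) ⟩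
            ν (2 ℕ.* i ℕ.+ 1 ℕ.+ 1) * evenTerm n i - ν (suc i ℕ.+ 1) * evenTerm n (suc i) ∎
        }
        where
        σ₁ : σ 1 ≈ - 1# * 1#
        σ₁ = trans (σₛ 0) (*-congˡ σ₀)

        double : ∀ i → 2 ℕ.* suc i ≡ 2 ℕ.* i ℕ.+ 1 ℕ.+ 1
        double i = ≡.trans (ℕ.*-distribˡ-+ 2 1 i) (≡.trans (ℕ.+-comm 2 (2 ℕ.* i)) (≡.sym (ℕ.+-assoc (2 ℕ.* i) 1 1)))

-- The two rational sequences

module RationalSequences where
  open Sequences ℚ.+-*-commutativeRing
  open StirlingSeries ℚ.+-*-commutativeRing

  toℚᵘ-fromℕℚ : ∀ n → ℚ.toℚᵘ (fromℕℚ n) ℚᵘ.≃ mkℚᵘ (+ n) 0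
  toℚᵘ-fromℕℚ n = ℚ.toℚᵘ-fromℚᵘ (mkℚᵘ (+ n) 0)

  fromℕℚ-suc : ∀ n → fromℕℚ (suc n) ≡ 1ℚ ℚ.+ fromℕℚ n
  fromℕℚ-suc n = ℚ.toℚᵘ-injective (begin
    ℚ.toℚᵘ (fromℕℚ (suc n))           ≈⟨ toℚᵘ-fromℕℚ (suc n) ⟩
    mkℚᵘ (+ suc n) 0                  ≈⟨ *≡* (≡.cong (λ i → (+ 1 ℤ.+ i) ℤ.* + 1) (≡.sym (ℤ.*-identityʳ (+ n)))) ⟩
    mkℚᵘ (+ 1) 0 ℚᵘ.+ mkℚᵘ (+ n) 0    ≈⟨ ℚᵘ.+-congʳ (mkℚᵘ (+ 1) 0) (toℚᵘ-fromℕℚ n) ⟨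
    ℚ.toℚᵘ 1ℚ ℚᵘ.+ ℚ.toℚᵘ (fromℕℚ n)  ≈⟨ ℚ.toℚᵘ-homo-+ 1ℚ (fromℕℚ n) ⟨
    ℚ.toℚᵘ (1ℚ ℚ.+ fromℕℚ n)          ∎)
    where open ℚᵘ.≃-Reasoning

  fromℕℚ≡ν : ∀ n → fromℕℚ n ≡ ν n
  fromℕℚ≡ν zero    = ≡.refl
  fromℕℚ≡ν (suc n) = ≡.trans (fromℕℚ-suc n) (≡.cong (1ℚ ℚ.+_) (fromℕℚ≡ν n))

  fromℕℚ-* : ∀ m n → fromℕℚ (m ℕ.* n) ≡ fromℕℚ m ℚ.* fromℕℚ n
  fromℕℚ-* m n = ≡.trans (fromℕℚ≡ν (m ℕ.* n)) (≡.trans (ν-* m n) (≡.sym (≡.cong₂ ℚ._*_ (fromℕℚ≡ν m) (fromℕℚ≡ν n))))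

  fromℕℚ-mono-≤ : ∀ {m n} → m ℕ.≤ n → fromℕℚ m ℚ.≤ fromℕℚ n
  fromℕℚ-mono-≤ {m} {n} m≤n = ℚ.toℚᵘ-cancel-≤ (begin
    ℚ.toℚᵘ (fromℕℚ m)   ≃⟨ toℚᵘ-fromℕℚ m ⟩
    mkℚᵘ (+ m) 0        ≤⟨ *≤* (ℤ.*-monoʳ-≤-nonNeg (+ 1) (ℤ.+≤+ m≤n)) ⟩
    mkℚᵘ (+ n) 0        ≃⟨ toℚᵘ-fromℕℚ n ⟨
    ℚ.toℚᵘ (fromℕℚ n)   ∎)
    where open ℚᵘ.≤-Reasoning

  fromℕℚ*1/ : ∀ d .{{_ : NonZero d}} → fromℕℚ d ℚ.* ((+ 1) ℚ./ d) ≡ 1ℚ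
  fromℕℚ*1/ d@(suc k) = ℚ.toℚᵘ-injective (begin
    ℚ.toℚᵘ (fromℕℚ d ℚ.* ((+ 1) ℚ./ d))              ≈⟨ ℚ.toℚᵘ-homo-* (fromℕℚ d) ((+ 1) ℚ./ d) ⟩
    ℚ.toℚᵘ (fromℕℚ d) ℚᵘ.* ℚ.toℚᵘ ((+ 1) ℚ./ d)      ≈⟨ ℚᵘ.*-cong (toℚᵘ-fromℕℚ d) (ℚ.toℚᵘ-fromℚᵘ (mkℚᵘ (+ 1) k)) ⟩
    mkℚᵘ (+ d) 0 ℚᵘ.* mkℚᵘ (+ 1) k                   ≈⟨ *≡*
        (≡.cong +_ (+-*-Solver.solve 1 (λ k → (con 1 :+ k) :* con 1 :* con 1 := con 1 :* (con 1 :* (con 1 :+ k)))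
        ≡.refl k)) ⟩
    mkℚᵘ (+ 1) 0                                     ∎)
    where
    open ℚᵘ.≃-Reasoning
    open +-*-Solver

  stirling : Stirling one expSeries-1 1/_! (power expSeries-1)
  stirling = record
    { δ₀    = ≡.refl
    ; δₛ    = λ _ → ≡.refl
    ; !*1/! = λ n → ≡.trans (≡.cong (ℚ._* 1/ n !) (≡.sym (fromℕℚ≡ν (n !)))) (fromℕℚ*1/ (n !) {{n !≢0}})
    ; e≈    = λ _ → ≡.refl
    ; p₀    = λ _ → ≡.refl
    ; pₛ    = λ _ _ → ≡.refl
    }
  module Str = Stirling stirling

  S≡ : ∀ n k → S n k ≡ Str.S₂ n k
  S≡ n k = ≡.cong (ℚ._* (power expSeries-1 k n ℚ.* 1/ k !)) (fromℕℚ≡ν (n !))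

  module Odd  = WeightedStirling 0 ℕ.z≤n
  module Even = WeightedStirling 1 ℕ.≤-refl

  oddSequence≡ : ∀ n → oddSequence n ≡ fromℕℚ (Odd.rows n 0)
  oddSequence≡ n = begin
    sign n ℚ.* Σ< (λ k → sign k ℚ.* S n k ℚ.* fromℕℚ [2 k -1]!!) (suc n)
      ≡⟨ Σ<-scale (sign n) (λ k → sign k ℚ.* S n k ℚ.* fromℕℚ [2 k -1]!!) (suc n) ⟨
    Σ< (λ k → sign n ℚ.* (sign k ℚ.* S n k ℚ.* fromℕℚ [2 k -1]!!)) (suc n)
      ≡⟨ Σ<-cong (λ k → ≡.cong₂ (λ x y → sign n ℚ.* (sign k ℚ.* x ℚ.* y)) (S≡ n k) (fromℕℚ≡ν [2 k -1]!!)) (suc n) ⟩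
    Σ< (Str.oddTerm sign ≡.refl (λ _ → ≡.refl) (ν ∘ [2_-1]!!) ≡.refl n) (suc n)
      ≡⟨ Odd.SignedTriangle.Σ-row (Str.oddTriangle sign ≡.refl (λ _ → ≡.refl) (ν ∘ [2_-1]!!) ≡.refl
          (λ k → ν-* (2 ℕ.* k ℕ.+ 1) [2 k -1]!!)) n ⟩
    ν (Odd.rows n 0)
      ≡⟨ fromℕℚ≡ν (Odd.rows n 0) ⟨
    fromℕℚ (Odd.rows n 0) ∎
    where open ≡-Reasoning

  [2suc_]!! : ∀ j → [2 suc j ]!! ≡ 2 ℕ.* suc j ℕ.* [2 j ]!!
  [2suc j ]!! = solve 3 (λ p j f → con 2 :* p :* ((con 1 :+ j) :* f) := con 2 :* (con 1 :+ j) :* (p :* f)) ≡.refl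
      (2 ℕ.^ j) j (j !)
    where open +-*-Solver

  evenSequence≡ : ∀ n → evenSequence (suc n) ≡ fromℕℚ (Even.rows n 0)
  evenSequence≡ n = begin
    sign (suc n) ℚ.* Σ< (λ k → sign (suc k) ℚ.* S (suc n) (suc k) ℚ.* fromℕℚ [2 k ]!!) (suc n)
      ≡⟨ Σ<-scale (sign (suc n)) (λ k → sign (suc k) ℚ.* S (suc n) (suc k) ℚ.* fromℕℚ [2 k ]!!) (suc n) ⟨
    Σ< (λ k → sign (suc n) ℚ.* (sign (suc k) ℚ.* S (suc n) (suc k) ℚ.* fromℕℚ [2 k ]!!)) (suc n)
      ≡⟨ Σ<-cong (λ k → ≡.cong₂ (λ x y → sign (suc n) ℚ.* (sign (suc k) ℚ.* x ℚ.* y)) (S≡ (suc n) (suc k))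
          (fromℕℚ≡ν [2 k ]!!)) (suc n) ⟩
    Σ< (Str.evenTerm sign ≡.refl (λ _ → ≡.refl) (ν ∘ [2_]!!) ≡.refl n) (suc n)
      ≡⟨ Even.SignedTriangle.Σ-row (Str.evenTriangle sign ≡.refl (λ _ → ≡.refl) (ν ∘ [2_]!!) ≡.refl
           (λ k → ≡.trans (≡.cong ν ([2suc k ]!!)) (ν-* (2 ℕ.* suc k) [2 k ]!!))) n ⟩
    ν (Even.rows n 0)
      ≡⟨ fromℕℚ≡ν (Even.rows n 0) ⟨
    fromℕℚ (Even.rows n 0) ∎
    where open ≡-Reasoning

  positive-increasing-logconvex : ∀ a (s : ℕ → ℚ) (r : ℕ → ℕ) → (∀ n → s (a ℕ.+ n) ≡ fromℕℚ (r n)) →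
    1 ℕ.≤ r 0 → (∀ n → r n ℕ.≤ r (suc n)) → (∀ n → r (suc n) ℕ.* r (suc n) ℕ.≤ r n ℕ.* r (2 ℕ.+ n)) →
    PositiveFrom a s × IncreasingFrom a s × LogConvexFrom a s
  positive-increasing-logconvex a s r s≡r 1≤r₀ r-inc r-logconvex = positive , increasing , logconvex
    where
    s≡ : ∀ {n} (a≤n : a ℕ.≤ n) → s n ≡ fromℕℚ (r (n ℕ.∸ a))
    s≡ {n} a≤n = ≡.trans (≡.cong s (≡.sym (ℕ.m+[n∸m]≡n a≤n))) (s≡r (n ℕ.∸ a))

    r-mono : ∀ m k → r m ℕ.≤ r (k ℕ.+ m)
    r-mono m zero    = ℕ.≤-refl
    r-mono m (suc k) = ℕ.≤-trans (r-mono m k) (r-inc (k ℕ.+ m))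

    increasing : IncreasingFrom a s
    increasing m n a≤m m≤n = ≡.subst₂ ℚ._≤_ (≡.sym (s≡ a≤m)) (≡.sym (s≡ (ℕ.≤-trans a≤m m≤n)))
      (fromℕℚ-mono-≤ (≡.subst (λ k → r (m ℕ.∸ a) ℕ.≤ r k) (ℕ.m∸n+n≡m (ℕ.∸-monoˡ-≤ a m≤n))
          (r-mono (m ℕ.∸ a) (n ℕ.∸ a ℕ.∸ (m ℕ.∸ a)))))

    positive : PositiveFrom a s
    positive n a≤n = ≡.subst (0ℚ ℚ.<_) (≡.sym (s≡ a≤n))
      (ℚ.<-≤-trans (ℚ.*<* (ℤ.+<+ ℕ.z<s)) (fromℕℚ-mono-≤
          (ℕ.≤-trans 1≤r₀ (≡.subst (λ k → r 0 ℕ.≤ r k) (ℕ.+-identityʳ _) (r-mono 0 (n ℕ.∸ a))))))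

    logconvex : LogConvexFrom a s
    logconvex (suc n) (ℕ.s≤s a≤n) = begin
      s (suc n) ℚ.* s (suc n)
        ≡⟨ ≡.cong₂ ℚ._*_ sₙ₊₁ sₙ₊₁ ⟩
      fromℕℚ (r (suc m)) ℚ.* fromℕℚ (r (suc m))
        ≡⟨ fromℕℚ-* (r (suc m)) (r (suc m)) ⟨
      fromℕℚ (r (suc m) ℕ.* r (suc m))
        ≤⟨ fromℕℚ-mono-≤ (r-logconvex m) ⟩
      fromℕℚ (r m ℕ.* r (2 ℕ.+ m))
        ≡⟨ fromℕℚ-* (r m) (r (2 ℕ.+ m)) ⟩
      fromℕℚ (r m) ℚ.* fromℕℚ (r (2 ℕ.+ m))
        ≡⟨ ≡.cong₂ ℚ._*_ (s≡ a≤n) (≡.trans (s≡ (ℕ.m≤n⇒m≤1+n (ℕ.m≤n⇒m≤1+n a≤n)))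
            (≡.cong (fromℕℚ ∘ r) (ℕ.+-∸-assoc 2 a≤n))) ⟨
      s n ℚ.* s (2 ℕ.+ n) ∎
      where
      open ℚ.≤-Reasoning
      m = n ℕ.∸ a
      sₙ₊₁ : s (suc n) ≡ fromℕℚ (r (suc m))
      sₙ₊₁ = ≡.trans (s≡ (ℕ.m≤n⇒m≤1+n a≤n)) (≡.cong (fromℕℚ ∘ r) (ℕ.+-∸-assoc 1 a≤n))

  oddSequence-properties : PositiveFrom 0 oddSequence × IncreasingFrom 0 oddSequence × LogConvexFrom 0 oddSequence
  oddSequence-properties = positive-increasing-logconvex 0 oddSequence (λ n → Odd.rows n 0) oddSequence≡
    -- `rows 0 0` and `diagonal 0` both compute to 1.
    ℕ.≤-refl (Odd.column₀-increasing ℕ.≤-refl) Odd.column₀-log-convex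

  evenSequence-properties : PositiveFrom 1 evenSequence × IncreasingFrom 1 evenSequence × LogConvexFrom 1 evenSequence
  evenSequence-properties = positive-increasing-logconvex 1 evenSequence (λ n → Even.rows n 0) evenSequence≡
    ℕ.≤-refl (Even.column₀-increasing ℕ.≤-refl) Even.column₀-log-convex

-- Constructive order and absolute bounds

module OrderedFieldProperties {c ℓ₁ ℓ₂} (F : OrderedHeytingField c ℓ₁ ℓ₂) where
  open OrderedHeytingField F
  open Algebra.Apartness.Properties.HeytingCommutativeRing heytingCommutativeRing using (invertibleˡ⇒#; x-0≈x; #-congʳ)
  open IntegerSolver commutativeRing

  -- Order goals are reduced to the sign of a difference, which the ring solver then rewrites.
  0<⇒< : ∀ {x y d} → 0# < d → d ≈ y - x → x < y
  0<⇒< {x} {y} {d} 0<d d≈y-x = <.<-respˡ-≈ (+-identityˡ x) (<.<-respʳ-≈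
    (trans (+-congʳ d≈y-x) (solve 2 (λ x y → y :- x :+ x := y) refl x y)) (+-monoˡ-< x 0<d))

  <⇒0< : ∀ {x y} → x < y → 0# < y - x
  <⇒0< {x} {y} x<y = <.<-respˡ-≈ (-‿inverseʳ x) (+-monoˡ-< (- x) x<y)

  0≤⇒≤ : ∀ {x y d} → 0# ≤ d → d ≈ y - x → x ≤ y
  0≤⇒≤ {x} {y} 0≤d d≈y-x y<x = 0≤d (0<⇒< (<⇒0< y<x)
    (trans (solve 2 (λ x y → x :- y := con (+ 0) :- (y :- x)) refl x y) (+-congˡ (-‿cong (sym d≈y-x)))))

  ≤⇒0≤ : ∀ {x y} → x ≤ y → 0# ≤ y - x
  ≤⇒0≤ {x} {y} x≤y d<0 = x≤y (0<⇒< (<⇒0< d<0) (solve 2 (λ x y → con (+ 0) :- (y :- x) := x :- y) refl x y))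

  <⇒≤ : ∀ {x y} → x < y → x ≤ y
  <⇒≤ = <.asym

  ≤-reflexive : ∀ {x y} → x ≈ y → x ≤ y
  ≤-reflexive x≈y = <.irrefl (sym x≈y)

  ≤-refl : ∀ {x} → x ≤ x
  ≤-refl = ≤-reflexive refl

  -- Cotransitivity does the work of trichotomy: y < z yields y < x, which is excluded, or x < z.
  ≤-<-trans : ∀ {x y z} → x ≤ y → y < z → x < z
  ≤-<-trans {x} x≤y y<z = [ (λ y<x → ⊥-elim (x≤y y<x)) , (λ x<z → x<z) ]′ (<-cotrans y<z x)

  <-≤-trans : ∀ {x y z} → x < y → y ≤ z → x < z
  <-≤-trans {z = z} x<y y≤z = [ (λ x<z → x<z) , (λ z<y → ⊥-elim (y≤z z<y)) ]′ (<-cotrans x<y z)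

  ≤-trans : ∀ {x y z} → x ≤ y → y ≤ z → x ≤ z
  ≤-trans x≤y y≤z z<x = y≤z (<-≤-trans z<x x≤y)

  ≤-respˡ : ∀ {x y z} → x ≈ y → x ≤ z → y ≤ z
  ≤-respˡ x≈y x≤z = ≤-trans (≤-reflexive (sym x≈y)) x≤z

  ≤-respʳ : ∀ {x y z} → x ≈ y → z ≤ x → z ≤ y
  ≤-respʳ x≈y z≤x = ≤-trans z≤x (≤-reflexive x≈y)

  ≤-antisym : ∀ {x y} → x ≤ y → y ≤ x → x ≈ y
  ≤-antisym {x} {y} x≤y y≤x = proj₁ (tight x y) λ x#y → [ y≤x , x≤y ]′ (#⇒<⊎> x#y)

  0<⇒# : ∀ {x} → 0# < x → x # 0#
  0<⇒# = #-sym ∘ <⇒#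

  0<+ : ∀ {x y} → 0# < x → 0# < y → 0# < x + y
  0<+ {x} {y} 0<x 0<y = <.trans 0<y (0<⇒< 0<x (solve 2 (λ x y → x := x :+ y :- y) refl x y))

  0≤+0< : ∀ {x y} → 0# ≤ x → 0# < y → 0# < x + y
  0≤+0< {x} {y} 0≤x 0<y = <-≤-trans 0<y (0≤⇒≤ 0≤x (solve 2 (λ x y → x := x :+ y :- y) refl x y))

  0≤+ : ∀ {x y} → 0# ≤ x → 0# ≤ y → 0# ≤ x + y
  0≤+ {x} {y} 0≤x 0≤y = ≤-trans 0≤y (0≤⇒≤ 0≤x (solve 2 (λ x y → x := x :+ y :- y) refl x y))

  x<0⇒0<-x : ∀ {x} → x < 0# → 0# < - x
  x<0⇒0<-x {x} x<0 = <.<-respʳ-≈ (+-identityˡ _) (<⇒0< x<0)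

  -- A factor of an invertible element is invertible, and invertible elements are apart from zero.
  *#0⇒#0ˡ : ∀ {x y} → x * y # 0# → x # 0#
  *#0⇒#0ˡ {x} {y} xy#0 with #⇒invertible xy#0
  ... | z , z*xy≈1 , _ = invertibleˡ⇒# (z * y , trans
    (solve 3 (λ x y z → (z :* y) :* (x :- con (+ 0)) := z :* (x :* y :- con (+ 0))) refl x y z) z*xy≈1)

  *#0⇒#0ʳ : ∀ {x y} → x * y # 0# → y # 0#
  *#0⇒#0ʳ {x} {y} xy#0 = *#0⇒#0ˡ (#-congʳ (*-comm x y) xy#0)

  -- A negative product is apart from zero, hence so are both factors; a nonnegative element apart
  -- from zero is positive, so the product would be positive too.
  0≤* : ∀ {x y} → 0# ≤ x → 0# ≤ y → 0# ≤ x * y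
  0≤* {x} {y} 0≤x 0≤y xy<0 = <.asym (*-pos (positive 0≤x (*#0⇒#0ˡ (<⇒# xy<0))) (positive 0≤y (*#0⇒#0ʳ (<⇒# xy<0)))) xy<0
    where
    positive : ∀ {z} → 0# ≤ z → z # 0# → 0# < z
    positive 0≤z z#0 = [ (λ z<0 → ⊥-elim (0≤z z<0)) , (λ 0<z → 0<z) ]′ (#⇒<⊎> z#0)

  *-monoʳ-≤ : ∀ {x y z} → 0# ≤ z → x ≤ y → z * x ≤ z * y
  *-monoʳ-≤ {x} {y} {z} 0≤z x≤y = 0≤⇒≤ (0≤* 0≤z (≤⇒0≤ x≤y))
      (solve 3 (λ x y z → z :* (y :- x) := z :* y :- z :* x) refl x y z)

  *-monoˡ-≤ : ∀ {x y z} → 0# ≤ z → x ≤ y → x * z ≤ y * z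
  *-monoˡ-≤ {x} {y} {z} 0≤z x≤y = 0≤⇒≤ (0≤* 0≤z (≤⇒0≤ x≤y))
      (solve 3 (λ x y z → z :* (y :- x) := y :* z :- x :* z) refl x y z)

  +-monoʳ-≤ : ∀ {x y} z → x ≤ y → z + x ≤ z + y
  +-monoʳ-≤ {x} {y} z x≤y = 0≤⇒≤ (≤⇒0≤ x≤y) (solve 3 (λ x y z → y :- x := z :+ y :- (z :+ x)) refl x y z)

  +-mono-≤ : ∀ {x y u v} → x ≤ y → u ≤ v → x + u ≤ y + v
  +-mono-≤ {x} {y} {u} {v} x≤y u≤v = 0≤⇒≤ (0≤+ (≤⇒0≤ x≤y) (≤⇒0≤ u≤v))
    (solve 4 (λ x y u v → (y :- x) :+ (v :- u) := y :+ v :- (x :+ u)) refl x y u v)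

  *-cancelʳ-<0 : ∀ {x z} → 0# < z → 0# < x * z → 0# < x
  *-cancelʳ-<0 {x} {z} 0<z 0<xz with #⇒<⊎> (*#0⇒#0ˡ (#-sym (<⇒# 0<xz)))
  ... | inj₂ 0<x = 0<x
  ... | inj₁ x<0 = ⊥-elim (<.asym 0<xz (0<⇒< (*-pos (x<0⇒0<-x x<0) 0<z)
      (solve 2 (λ x z → (:- x) :* z := con (+ 0) :- x :* z) refl x z)))

  *-inverseʳ : ∀ {x} (x#0 : x # 0#) → x * recip x#0 ≈ 1#
  *-inverseʳ {x} x#0 = trans (*-congʳ (sym (x-0≈x x))) (proj₂ (proj₂ (#⇒invertible x#0)))

  0<recip : ∀ {x} (x#0 : x # 0#) → 0# < x → 0# < recip x#0
  0<recip {x} x#0 0<x = *-cancelʳ-<0 0<x (<.<-respʳ-≈ (trans (sym (*-inverseʳ x#0)) (*-comm _ _)) 0<1)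

  _⁻¹₊ : ∀ {x} → 0# < x → Carrier
  0<x ⁻¹₊ = recip (0<⇒# 0<x)

  *⁻¹₊ : ∀ {x} (0<x : 0# < x) → x * 0<x ⁻¹₊ ≈ 1#
  *⁻¹₊ 0<x = *-inverseʳ (0<⇒# 0<x)

  0<⁻¹₊ : ∀ {x} (0<x : 0# < x) → 0# < 0<x ⁻¹₊
  0<⁻¹₊ 0<x = 0<recip (0<⇒# 0<x) 0<x

  *-cancelˡ-≈ : ∀ {x y z} → 0# < z → z * x ≈ z * y → x ≈ y
  *-cancelˡ-≈ {x} {y} {z} 0<z zx≈zy = trans (insert x) (trans (*-congˡ zx≈zy) (sym (insert y)))
    where
    insert : ∀ w → w ≈ 0<z ⁻¹₊ * (z * w)
    insert w = sym (trans (solve 3 (λ i z w → i :* (z :* w) := (z :* i) :* w) refl (0<z ⁻¹₊) z w)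
        (trans (*-congʳ (*⁻¹₊ 0<z)) (*-identityˡ w)))

  0<2 : 0# < 1# + 1#
  0<2 = 0<+ 0<1 0<1

  ½ : Carrier
  ½ = 0<2 ⁻¹₊

  0<½ : 0# < ½
  0<½ = 0<⁻¹₊ 0<2

  ½+½ : ∀ x → x * ½ + x * ½ ≈ x
  ½+½ x = trans (solve 2 (λ x h → x :* h :+ x :* h := x :* ((con (+ 1) :+ con (+ 1)) :* h)) refl x ½)
      (trans (*-congˡ (*⁻¹₊ 0<2)) (*-identityʳ x))

  0<x+x⇒0<x : ∀ {x} → 0# < x + x → 0# < x
  0<x+x⇒0<x {x} 0<2x = *-cancelʳ-<0 0<2 (<.<-respʳ-≈ (solve 1 (λ x → x :+ x := x :* (con (+ 1) :+ con (+ 1))) refl x)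
      0<2x)

  0≤x+x⇒0≤x : ∀ {x} → 0# ≤ x + x → 0# ≤ x
  0≤x+x⇒0≤x {x} 0≤2x x<0 = 0≤2x (0<⇒< (0<+ (x<0⇒0<-x x<0) (x<0⇒0<-x x<0))
      (solve 1 (λ x → :- x :+ :- x := con (+ 0) :- (x :+ x)) refl x))

  0≤fromℕ : ∀ n → 0# ≤ fromℕ n
  0≤fromℕ zero    = ≤-refl
  0≤fromℕ (suc n) = <⇒≤ (0<fromℕ n)

  infix 4 ∣_∣<_ ∣_∣≤_
  -- Two-sided bounds replace an absolute value. `Within ε x y` is `∣ x - y ∣< ε` by definition, so
  -- convergence in the axioms needs no translation.
  ∣_∣<_ : Carrier → Carrier → Set ℓ₂
  ∣ x ∣< b = (- b < x) × (x < b)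

  ∣_∣≤_ : Carrier → Carrier → Set ℓ₂
  ∣ x ∣≤ b = (- b ≤ x) × (x ≤ b)

  ∣∣<-cong : ∀ {x y b} → x ≈ y → ∣ x ∣< b → ∣ y ∣< b
  ∣∣<-cong x≈y (-b<x , x<b) = <.<-respʳ-≈ x≈y -b<x , <.<-respˡ-≈ x≈y x<b

  ∣∣≤-resp : ∀ {x y b d} → x ≈ y → b ≈ d → ∣ x ∣≤ b → ∣ y ∣≤ d
  ∣∣≤-resp x≈y b≈d (p , q) = ≤-respˡ (-‿cong b≈d) (≤-respʳ x≈y p) , ≤-respʳ b≈d (≤-respˡ x≈y q)

  ∣0∣≤0 : ∣ 0# ∣≤ 0#
  ∣0∣≤0 = ≤-reflexive (solve 0 (:- con (+ 0) := con (+ 0)) refl) , ≤-refl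

  ∣nonneg∣≤ : ∀ {x} → 0# ≤ x → ∣ x ∣≤ x
  ∣nonneg∣≤ {x} 0≤x = 0≤⇒≤ (0≤+ 0≤x 0≤x) (solve 1 (λ x → x :+ x := x :- (:- x)) refl x) , ≤-refl

  ∣∣<-weaken : ∀ {x b d} → b ≤ d → ∣ x ∣< b → ∣ x ∣< d
  ∣∣<-weaken {x} {b} {d} b≤d (-b<x , x<b) =
    ≤-<-trans (0≤⇒≤ (≤⇒0≤ b≤d) (solve 2 (λ b d → d :- b := (:- b) :- (:- d)) refl b d)) -b<x , <-≤-trans x<b b≤d

  ∣∣<⇒∣∣≤ : ∀ {x b} → ∣ x ∣< b → ∣ x ∣≤ b
  ∣∣<⇒∣∣≤ (p , q) = <⇒≤ p , <⇒≤ q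

  ∣∣<⇒0< : ∀ {x b} → ∣ x ∣< b → 0# < b
  ∣∣<⇒0< {x} {b} (-b<x , x<b) = 0<x+x⇒0<x (<.<-respʳ-≈ (solve 1 (λ b → b :- (:- b) := b :+ b) refl b)
      (<⇒0< (<.trans -b<x x<b)))

  ∣∣<-neg : ∀ {x b} → ∣ x ∣< b → ∣ - x ∣< b
  ∣∣<-neg {x} {b} (-b<x , x<b) =
    0<⇒< (<⇒0< x<b) (solve 2 (λ x b → b :- x := (:- x) :- (:- b)) refl x b) ,
    0<⇒< (<⇒0< -b<x) (solve 2 (λ x b → x :- (:- b) := b :- (:- x)) refl x b)

  ∣∣<-+ : ∀ {x y b d} → ∣ x ∣< b → ∣ y ∣< d → ∣ x + y ∣< b + d
  ∣∣<-+ {x} {y} {b} {d} (-b<x , x<b) (-d<y , y<d) =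
    0<⇒< (0<+ (<⇒0< -b<x) (<⇒0< -d<y)) (solve 4 (λ x y b d → (x :- (:- b)) :+ (y :- (:- d)) := x :+ y :-
        (:- (b :+ d))) refl x y b d) ,
    0<⇒< (0<+ (<⇒0< x<b) (<⇒0< y<d)) (solve 4 (λ x y b d → (b :- x) :+ (d :- y) := b :+ d :- (x :+ y)) refl x y b d)

  ∣∣≤-+ : ∀ {x y b d} → ∣ x ∣≤ b → ∣ y ∣≤ d → ∣ x + y ∣≤ b + d
  ∣∣≤-+ {x} {y} {b} {d} (-b≤x , x≤b) (-d≤y , y≤d) =
    0≤⇒≤ (0≤+ (≤⇒0≤ -b≤x) (≤⇒0≤ -d≤y)) (solve 4 (λ x y b d → (x :- (:- b)) :+ (y :- (:- d)) := x :+ y :-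
        (:- (b :+ d))) refl x y b d) ,
    0≤⇒≤ (0≤+ (≤⇒0≤ x≤b) (≤⇒0≤ y≤d)) (solve 4 (λ x y b d → (b :- x) :+ (d :- y) := b :+ d :- (x :+ y)) refl x y b d)

  -- 2 (b d ∓ x y) = (b - x) (d ± y) + (b + x) (d ∓ y)
  ∣∣<-* : ∀ {x y b d} → ∣ x ∣< b → ∣ y ∣< d → ∣ x * y ∣< b * d
  ∣∣<-* {x} {y} {b} {d} (-b<x , x<b) (-d<y , y<d) =
    0<⇒< (0<x+x⇒0<x (<.<-respʳ-≈ (solve 4 (λ x y b d → (b :- x) :* (d :- y) :+ (x :- (:- b)) :* (y :- (:- d))
        := (x :* y :- (:- (b :* d))) :+ (x :* y :- (:- (b :* d)))) refl x y b d)
      (0<+ (*-pos (<⇒0< x<b) (<⇒0< y<d)) (*-pos (<⇒0< -b<x) (<⇒0< -d<y))))) refl ,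
    0<⇒< (0<x+x⇒0<x (<.<-respʳ-≈ (solve 4 (λ x y b d → (b :- x) :* (y :- (:- d)) :+ (x :- (:- b)) :* (d :- y)
        := (b :* d :- x :* y) :+ (b :* d :- x :* y)) refl x y b d)
      (0<+ (*-pos (<⇒0< x<b) (<⇒0< -d<y)) (*-pos (<⇒0< -b<x) (<⇒0< y<d))))) refl

  ∣∣≤-* : ∀ {x y b d} → ∣ x ∣≤ b → ∣ y ∣≤ d → ∣ x * y ∣≤ b * d
  ∣∣≤-* {x} {y} {b} {d} (-b≤x , x≤b) (-d≤y , y≤d) =
    0≤⇒≤ (0≤x+x⇒0≤x (≤-respʳ (solve 4 (λ x y b d → (b :- x) :* (d :- y) :+ (x :- (:- b)) :* (y :- (:- d))
        := (x :* y :- (:- (b :* d))) :+ (x :* y :- (:- (b :* d)))) refl x y b d)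
      (0≤+ (0≤* (≤⇒0≤ x≤b) (≤⇒0≤ y≤d)) (0≤* (≤⇒0≤ -b≤x) (≤⇒0≤ -d≤y))))) refl ,
    0≤⇒≤ (0≤x+x⇒0≤x (≤-respʳ (solve 4 (λ x y b d → (b :- x) :* (y :- (:- d)) :+ (x :- (:- b)) :* (d :- y)
        := (b :* d :- x :* y) :+ (b :* d :- x :* y)) refl x y b d)
      (0≤+ (0≤* (≤⇒0≤ x≤b) (≤⇒0≤ -d≤y)) (0≤* (≤⇒0≤ -b≤x) (≤⇒0≤ y≤d))))) refl

  ∣∣<∀⇒≈0 : ∀ {x} → (∀ ε → 0# < ε → ∣ x ∣< ε) → x ≈ 0#
  ∣∣<∀⇒≈0 {x} small = ≤-antisym
    (λ 0<x → <.irrefl refl (proj₂ (small x 0<x)))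
    (λ x<0 → <.irrefl refl (<.<-respˡ-≈ (solve 1 (λ x → :- (:- x) := x) refl x) (proj₁ (small (- x) (x<0⇒0<-x x<0)))))

-- Limits along filter bases

-- A filter base on Index; sequences and difference quotients are treated alike.
record FilterBase i s a : Set (lsuc (i ⊔ s ⊔ a)) where
  field
    Index : Set i
    Stage : Set s
    At    : Stage → Index → Set a
    start : Stage
    meet  : ∀ s t → ∃[ u ] (∀ {n} → At u n → At s n × At t n)

module Limits {c ℓ₁ ℓ₂} (R : RealNumbers c ℓ₁ ℓ₂) {i s a} (B : FilterBase i s a) where
  open RealNumbers R
  open OrderedFieldProperties orderedHeytingField
  open IntegerSolver commutativeRing
  open FilterBase B

  Function : Set (c ⊔ i)
  Function = Index → Carrier

  Eventually : (Index → Set ℓ₂) → Set (s ⊔ i ⊔ a ⊔ ℓ₂)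
  Eventually P = ∃[ t ] (∀ n → At t n → P n)

  Bounded : Function → Set (c ⊔ s ⊔ i ⊔ a ⊔ ℓ₂)
  Bounded f = ∃[ b ] Eventually (λ n → ∣ f n ∣< b)

  Null : Function → Set (c ⊔ s ⊔ i ⊔ a ⊔ ℓ₂)
  Null f = ∀ ε → 0# < ε → Eventually (λ n → ∣ f n ∣< ε)

  infix 4 _⟶_
  _⟶_ : Function → Carrier → Set (c ⊔ s ⊔ i ⊔ a ⊔ ℓ₂)
  f ⟶ l = Null (λ n → f n - l)

  both : ∀ {P Q : Index → Set ℓ₂} → Eventually P → Eventually Q → Eventually (λ n → P n × Q n)
  both (t , p) (u , q) with meet t u
  ... | v , tu = v , λ n v∋n → p n (proj₁ (tu v∋n)) , q n (proj₂ (tu v∋n))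

  eventually-map : ∀ {P Q : Index → Set ℓ₂} → (∀ n → P n → Q n) → Eventually P → Eventually Q
  eventually-map f (t , p) = t , λ n t∋n → f n (p n t∋n)

  null-cong : ∀ {f g} → (∀ n → f n ≈ g n) → Null f → Null g
  null-cong f≈g null-f ε 0<ε = eventually-map (λ n → ∣∣<-cong (f≈g n)) (null-f ε 0<ε)

  null-+ : ∀ {f g} → Null f → Null g → Null (λ n → f n + g n)
  null-+ null-f null-g ε 0<ε = eventually-map
    (λ n (f< , g<) → ∣∣<-weaken (≤-reflexive (½+½ ε)) (∣∣<-+ f< g<))
    (both (null-f (ε * ½) (*-pos 0<ε 0<½)) (null-g (ε * ½) (*-pos 0<ε 0<½)))

  null-neg : ∀ {f} → Null f → Null (λ n → - f n)
  null-neg null-f ε 0<ε = eventually-map (λ n → ∣∣<-neg) (null-f ε 0<ε)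

  null-* : ∀ {f g} → Null f → Bounded g → Null (λ n → f n * g n)
  null-* null-f (b , g<b) ε 0<ε = eventually-map
    (λ n (f< , g<) → ∣∣<-weaken (≤-reflexive (cancel 0<b′)) (∣∣<-* f< (∣∣<-weaken (b≤b′) g<)))
    (both (null-f (ε * 0<b′ ⁻¹₊) (*-pos 0<ε (0<⁻¹₊ 0<b′))) g<b)
    where
    -- A positive integer above `b`, by which ε can be divided; `b` comes with no proof of
    -- positivity.
    n = proj₁ (archimedean b)
    b′ = fromℕ (suc n)

    0<b′ : 0# < b′
    0<b′ = 0<fromℕ n

    b≤b′ : b ≤ b′
    b≤b′ = <⇒≤ (<.trans (proj₂ (archimedean b)) (0<⇒< 0<1
        (solve 1 (λ x → con (+ 1) := con (+ 1) :+ x :- x) refl (fromℕ n))))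

    cancel : ∀ {z} (0<z : 0# < z) → ε * 0<z ⁻¹₊ * z ≈ ε
    cancel {z} 0<z = trans (solve 3 (λ e i z → e :* i :* z := e :* (z :* i)) refl ε (0<z ⁻¹₊) z)
        (trans (*-congˡ (*⁻¹₊ 0<z)) (*-identityʳ ε))

  -- The sign of x is not decidable, so m bounds x, n bounds - x, and m + n serves for both.
  bounded-const : ∀ x → Bounded (λ _ → x)
  bounded-const x with archimedean x | archimedean (- x)
  ... | m , x<m | n , -x<n = fromℕ m + fromℕ n , start , λ _ _ →
    0<⇒< (0≤+0< (0≤fromℕ m) (<⇒0< -x<n)) (solve 3 (λ x m n → m :+ (n :- (:- x)) := x :- (:- (m :+ n))) refl x
        (fromℕ m) (fromℕ n)) ,
    0<⇒< (0≤+0< (0≤fromℕ n) (<⇒0< x<m)) (solve 3 (λ x m n → n :+ (m :- x) := m :+ n :- x) refl x (fromℕ m) (fromℕ n))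

  bounded-+ : ∀ {f g} → Bounded f → Bounded g → Bounded (λ n → f n + g n)
  bounded-+ (b , f<) (d , g<) = b + d , eventually-map (λ n (p , q) → ∣∣<-+ p q) (both f< g<)

  bounded-* : ∀ {f g} → Bounded f → Bounded g → Bounded (λ n → f n * g n)
  bounded-* (b , f<) (d , g<) = b * d , eventually-map (λ n (p , q) → ∣∣<-* p q) (both f< g<)

  bounded-cong : ∀ {f g} → (∀ n → f n ≈ g n) → Bounded f → Bounded g
  bounded-cong f≈g (b , f<) = b , eventually-map (λ n → ∣∣<-cong (f≈g n)) f<

  ⟶⇒bounded : ∀ {f l} → f ⟶ l → Bounded f
  ⟶⇒bounded {f} {l} f→l = bounded-cong (λ n → solve 2 (λ x l → x :- l :+ l := x) refl (f n) l)
    (bounded-+ (1# , f→l 1# 0<1) (bounded-const l))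

  ⟶-cong : ∀ {f g l m} → (∀ n → f n ≈ g n) → l ≈ m → f ⟶ l → g ⟶ m
  ⟶-cong f≈g l≈m = null-cong (λ n → +-cong (f≈g n) (-‿cong l≈m))

  ⟶-const : ∀ l → (λ _ → l) ⟶ l
  ⟶-const l ε 0<ε = start , λ _ _ →
    0<⇒< 0<ε (solve 2 (λ e l → e := l :- l :- (:- e)) refl ε l) ,
    0<⇒< 0<ε (solve 2 (λ e l → e := e :- (l :- l)) refl ε l)

  ⟶-+ : ∀ {f g l m} → f ⟶ l → g ⟶ m → (λ n → f n + g n) ⟶ l + m
  ⟶-+ {f} {g} {l} {m} f→l g→m = null-cong
    (λ n → solve 4 (λ x y l m → (x :- l) :+ (y :- m) := x :+ y :- (l :+ m)) refl (f n) (g n) l m) (null-+ f→l g→m)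

  ⟶-neg : ∀ {f l} → f ⟶ l → (λ n → - f n) ⟶ - l
  ⟶-neg {f} {l} f→l = null-cong (λ n → solve 2 (λ x l → :- (x :- l) := :- x :- (:- l)) refl (f n) l) (null-neg f→l)

  ⟶-* : ∀ {f g l m} → f ⟶ l → g ⟶ m → (λ n → f n * g n) ⟶ l * m
  ⟶-* {f} {g} {l} {m} f→l g→m = null-cong
    (λ n → solve 4 (λ x y l m → (x :- l) :* y :+ (y :- m) :* l := x :* y :- l :* m) refl (f n) (g n) l m)
    (null-+ (null-* f→l (⟶⇒bounded g→m)) (null-* g→m (bounded-const l)))

  -- The order of the two bounds may vary with the index, because division by y - x reverses
  -- inequalities when y < x.
  squeeze : ∀ {f g h l} → f ⟶ l → h ⟶ l →
    (∀ n → (f n ≤ g n × g n ≤ h n) ⊎ (h n ≤ g n × g n ≤ f n)) → g ⟶ l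
  squeeze {f} {g} {h} {l} f→l h→l between ε 0<ε = eventually-map
    (λ n ((l<f , f<u) , (l<h , h<u)) → [ (λ (f≤g , g≤h) → <-≤-trans l<f (shift f≤g) , ≤-<-trans (shift g≤h) h<u)
                                       , (λ (h≤g , g≤f) → <-≤-trans l<h (shift h≤g) , ≤-<-trans (shift g≤f) f<u) ]′
                                           (between n))
    (both (f→l ε 0<ε) (h→l ε 0<ε))
    where
    shift : ∀ {x y} → x ≤ y → x - l ≤ y - l
    shift {x} {y} x≤y = 0≤⇒≤ (≤⇒0≤ x≤y) (solve 3 (λ x y l → y :- x := y :- l :- (x :- l)) refl x y l)

  -- Eventually l / 2 < f, hence g < 2 k; then g - k = (l - f) (g k).
  ⟶-inverse : ∀ {f g l k} → f ⟶ l → 0# < l → l * k ≈ 1# → (∀ n → f n * g n ≈ 1#) → (∀ n → 0# < g n) → g ⟶ k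
  ⟶-inverse {f} {g} {l} {k} f→l 0<l lk≈1 fg≈1 0<g = null-cong identity
    (null-* (null-neg f→l) (bounded-* (k + k , eventually-map bound (f→l (l * ½) (*-pos 0<l 0<½))) (bounded-const k)))
    where
    0<k : 0# < k
    0<k = *-cancelʳ-<0 0<l (<.<-respʳ-≈ (trans (sym lk≈1) (*-comm l k)) 0<1)

    identity : ∀ n → - (f n - l) * (g n * k) ≈ g n - k
    identity n = trans
      (solve 4 (λ f g l k → (:- (f :- l)) :* (g :* k) := (l :* k) :* g :- (f :* g) :* k) refl (f n) (g n) l k)
      (+-cong (trans (*-congʳ lk≈1) (*-identityˡ _)) (-‿cong (trans (*-congʳ (fg≈1 n)) (*-identityˡ _))))

    bound : ∀ n → ∣ f n - l ∣< l * ½ → ∣ g n ∣< k + k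
    bound n (lower , _) = 0<⇒< (0<+ (0<g n) (0<+ 0<k 0<k))
        (solve 2 (λ g k → g :+ (k :+ k) := g :- (:- (k :+ k))) refl (g n) k) ,
      -- 0 < g · 2k · (f - l/2) = 2k - g, by f g = 1 and l k = 1.
      0<⇒< (*-pos (*-pos (0<g n) (0<+ 0<k 0<k)) (<⇒0< lower)) (trans
        (solve 5 (λ f g l k h → g :* (k :+ k) :* (f :- l :- (:- (l :* h))) :=
           (f :* g) :* (k :+ k) :- (l :* k) :* g :* (con (+ 1) :+ con (+ 1) :- (con (+ 1) :* h :+ con (+ 1) :* h)))
               refl (f n) (g n) l k ½)
        (+-cong (trans (*-congʳ (fg≈1 n)) (*-identityˡ _)) (-‿cong (trans
          (*-cong (trans (*-congʳ lk≈1) (*-identityˡ _))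
              (trans (+-congˡ (-‿cong (½+½ 1#))) (solve 0 (con (+ 1) :+ con (+ 1) :- con (+ 1) := con (+ 1)) refl)))
          (*-identityʳ _)))))

module SequenceLimits {c ℓ₁ ℓ₂} (R : RealNumbers c ℓ₁ ℓ₂) where
  open RealNumbers R
  open OrderedFieldProperties orderedHeytingField
  open IntegerSolver commutativeRing

  sequences : FilterBase _ _ _
  sequences = record
    { Index = ℕ
    ; Stage = ℕ
    ; At    = ℕ._≤_
    ; start = 0
    ; meet  = λ m n → m ℕ.⊔ n , λ m⊔n≤ → ℕ.≤-trans (ℕ.m≤m⊔n m n) m⊔n≤ , ℕ.≤-trans (ℕ.m≤n⊔m m n) m⊔n≤
    }

  open Limits R sequences public

  null-const⇒≈0 : ∀ {x} → Null (λ _ → x) → x ≈ 0#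
  null-const⇒≈0 null = ∣∣<∀⇒≈0 λ ε 0<ε → let (n , small) = null ε 0<ε in small n ℕ.≤-refl

  ⟶-unique : ∀ {f l m} → f ⟶ l → f ⟶ m → l ≈ m
  ⟶-unique {f} {l} {m} f→l f→m = trans (solve 2 (λ l m → l := (l :- m) :+ m) refl l m)
    (trans (+-congʳ (null-const⇒≈0 (null-cong (λ n → solve 3 (λ x l m → (x :- m) :+ :- (x :- l) := l :- m) refl (f n)
        l m)
      (null-+ f→m (null-neg f→l))))) (+-identityˡ m))

  ⟶-≤ : ∀ {f l x} N → (∀ n → N ℕ.≤ n → x ≤ f n) → f ⟶ l → x ≤ l
  ⟶-≤ {f} {l} {x} N x≤f f→l l<x with f→l (x - l) (<⇒0< l<x)
  ... | M , near = x≤f (N ℕ.⊔ M) (ℕ.m≤m⊔n N M)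
    (0<⇒< (<⇒0< (proj₂ (near (N ℕ.⊔ M) (ℕ.m≤n⊔m N M))))
        (solve 3 (λ x y l → x :- l :- (y :- l) := x :- y) refl x (f (N ℕ.⊔ M)) l))

  ⟶-subsequence : ∀ {f l} (φ : ℕ → ℕ) → (∀ n → n ℕ.≤ φ n) → f ⟶ l → (f ∘ φ) ⟶ l
  ⟶-subsequence φ n≤φ f→l ε 0<ε with f→l ε 0<ε
  ... | N , near = N , λ n N≤n → near (φ n) (ℕ.≤-trans N≤n (n≤φ n))

-- Majorised Cauchy products and the exponential function

module SumBounds {c ℓ₁ ℓ₂} (F : OrderedHeytingField c ℓ₁ ℓ₂) where
  open OrderedHeytingField F
  open OrderedFieldProperties F
  open IntegerSolver commutativeRing
  open Sequences commutativeRing hiding (sum; _·_)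

  Σ<-nonneg : ∀ {f} → (∀ i → 0# ≤ f i) → ∀ n → 0# ≤ Σ< f n
  Σ<-nonneg 0≤f zero    = ≤-refl
  Σ<-nonneg 0≤f (suc n) = 0≤+ (0≤f 0) (Σ<-nonneg (0≤f ∘ suc) n)

  Σ<-mono : ∀ {f} → (∀ i → 0# ≤ f i) → ∀ {m n} → m ℕ.≤ n → Σ< f m ≤ Σ< f n
  Σ<-mono 0≤f {n = n} ℕ.z≤n     = Σ<-nonneg 0≤f n
  Σ<-mono 0≤f         (ℕ.s≤s m≤n) = +-monoʳ-≤ _ (Σ<-mono (0≤f ∘ suc) m≤n)

  ⋆-nonneg : ∀ {f g} → (∀ i → 0# ≤ f i) → (∀ i → 0# ≤ g i) → ∀ n → 0# ≤ (f ⋆ g) n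
  ⋆-nonneg 0≤f 0≤g zero    = 0≤+ (0≤* (0≤f 0) (0≤g 0)) ≤-refl
  ⋆-nonneg 0≤f 0≤g (suc n) = 0≤+ (0≤* (0≤f 0) (0≤g (suc n))) (⋆-nonneg (0≤f ∘ suc) 0≤g n)

  tail-bound : ∀ {b B} → (∀ i → ∣ b i ∣≤ B i) → ∀ {n m} → n ℕ.≤ m → ∣ Σ< b m - Σ< b n ∣≤ Σ< B m - Σ< B n
  tail-bound {b} {B} b≤B {m = m} ℕ.z≤n = ∣∣≤-resp (sub0 _) (sub0 _) (sum-bound b≤B m)
    where
    sub0 : ∀ x → x ≈ x - 0#
    sub0 = solve 1 (λ x → x := x :- con (+ 0)) refl
    sum-bound : ∀ {b B} → (∀ i → ∣ b i ∣≤ B i) → ∀ n → ∣ Σ< b n ∣≤ Σ< B n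
    sum-bound b≤B zero    = ∣0∣≤0
    sum-bound b≤B (suc n) = ∣∣≤-+ (b≤B 0) (sum-bound (b≤B ∘ suc) n)
  tail-bound {b} {B} b≤B (ℕ.s≤s n≤m) = ∣∣≤-resp (shift (b 0) _ _) (shift (B 0) _ _) (tail-bound (b≤B ∘ suc) n≤m)
    where
    shift : ∀ a x y → x - y ≈ a + x - (a + y)
    shift = solve 3 (λ a x y → x :- y := a :+ x :- (a :+ y)) refl

  -- The difference is the sum of `a i * b j` over i < n and n - i ≤ j < m, so the same sum for the
  -- majorants dominates it.
  product-bound : ∀ {a A b B} → (∀ i → ∣ a i ∣≤ A i) → (∀ i → ∣ b i ∣≤ B i) → ∀ {n m} → n ℕ.≤ m →
    ∣ Σ< a n * Σ< b m - (a ⋆ Σ< b) n ∣≤ Σ< A n * Σ< B m - (A ⋆ Σ< B) n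
  product-bound {a} {A} {b} {B} a≤A b≤B {zero}  {m} _     = ∣∣≤-resp (vanish (Σ< b m) (a 0)) (vanish (Σ< B m) (A 0))
      ∣0∣≤0
    where
    vanish : ∀ x y → 0# ≈ 0# * x - (y * 0# + 0#)
    vanish = solve 2 (λ x y → con (+ 0) := con (+ 0) :* x :- (y :* con (+ 0) :+ con (+ 0))) refl
  product-bound {a} {A} {b} {B} a≤A b≤B {suc n} {m} n<m   = ∣∣≤-resp (split (a 0) _ _ _ _) (split (A 0) _ _ _ _)
    (∣∣≤-+ (∣∣≤-* (a≤A 0) (tail-bound b≤B n<m)) (product-bound (a≤A ∘ suc) b≤B (ℕ.≤-trans (ℕ.n≤1+n n) n<m)))
    where
    split : ∀ a s t u v → a * (t - u) + (s * t - v) ≈ (a + s) * t - (a * u + v)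
    split = solve 5 (λ a s t u v → a :* (t :- u) :+ (s :* t :- v) := (a :+ s) :* t :- (a :* u :+ v)) refl

  -- The rectangle i < n, j < m lies in the triangle i + j < n + m.
  product≤⋆ : ∀ {A B} → (∀ i → 0# ≤ A i) → (∀ i → 0# ≤ B i) → ∀ n m → Σ< A n * Σ< B m ≤ (A ⋆ Σ< B) (n ℕ.+ m)
  product≤⋆ 0≤A 0≤B zero    m = ≤-respˡ (sym (zeroˡ _)) (⋆-nonneg 0≤A (Σ<-nonneg 0≤B) m)
  product≤⋆ 0≤A 0≤B (suc n) m = ≤-respˡ (sym (distribʳ _ _ _))
    (+-mono-≤ (*-monoʳ-≤ (0≤A 0) (Σ<-mono 0≤B (ℕ.m≤n+m m (suc n)))) (product≤⋆ (0≤A ∘ suc) 0≤B n m))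

module Exponential {c ℓ₁ ℓ₂} (R : RealNumbers c ℓ₁ ℓ₂) (E : ElementaryFunctions R) where
  open RealNumbers R
  open ElementaryFunctions E
  open OrderedFieldProperties orderedHeytingField
  open SumBounds orderedHeytingField
  open IntegerSolver commutativeRing
  open Sequences commutativeRing hiding (sum; _·_)
  open SequenceLimits R
  open Relation.Binary.Reasoning.Setoid setoid

  1/!ᴿ : ℕ → Carrier
  1/!ᴿ k = recip (fromℕ#0 (k !) {{k !≢0}})

  term : Carrier → ℕ → Carrier
  term x k = x ^ k * 1/!ᴿ k

  !*1/!ᴿ : ∀ k → ν (k !) * 1/!ᴿ k ≈ 1#
  !*1/!ᴿ k = *-inverseʳ (fromℕ#0 (k !) {{k !≢0}})

  term₀ : ∀ x → term x 0 ≈ 1#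
  term₀ x = trans (*-congʳ (sym ν1≈1)) (!*1/!ᴿ 0)

  ∂-term : ∀ x → ∂ (term x) ≋ scale x (term x)
  ∂-term x n = trans (solve 4 (λ m x p i → m :* (x :* p :* i) := x :* (p :* (m :* i))) refl (ν (suc n)) x (x ^ n)
      (1/!ᴿ (suc n)))
    (*-congˡ (*-congˡ (∂-inverse-factorial {1/!ᴿ} !*1/!ᴿ n)))

  term₁ : ∀ x → term x 1 ≈ x
  term₁ x = trans (sym (trans (*-congʳ ν1≈1) (*-identityˡ _)))
      (trans (∂-term x 0) (trans (*-congˡ (term₀ x)) (*-identityʳ x)))

  term-cong : ∀ {x y} → x ≈ y → term x ≋ term y
  term-cong {x} {y} x≈y k = *-congʳ (^-cong k)
    where
    ^-cong : ∀ k → x ^ k ≈ y ^ k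
    ^-cong zero    = refl
    ^-cong (suc k) = *-cong x≈y (^-cong k)

  -- The binomial theorem without binomial coefficients: both sides satisfy ∂ s = (x + y) s and s 0
  -- = 1, and division by n + 1 makes the solution unique.
  term-⋆ : ∀ x y → term x ⋆ term y ≋ term (x + y)
  term-⋆ x y zero    = trans (+-identityʳ _) (trans (*-cong (term₀ x) (term₀ y))
      (trans (*-identityˡ 1#) (sym (term₀ (x + y)))))
  term-⋆ x y (suc n) = *-cancelˡ-≈ (0<fromℕ n) (begin
    ∂ (term x ⋆ term y) n
      ≈⟨ leibniz (term x) (term y) n ⟩
    (∂ (term x) ⋆ term y) n + (term x ⋆ ∂ (term y)) n
      ≈⟨ +-cong (trans (⋆-cong {g = term y} (∂-term x) (λ _ → refl) n) (scale-⋆ x (term x) (term y) n))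
                (trans (⋆-cong {term x} (λ _ → refl) (∂-term y) n) (⋆-scale y (term x) (term y) n)) ⟩
    x * (term x ⋆ term y) n + y * (term x ⋆ term y) n
      ≈⟨ distribʳ _ _ _ ⟨
    (x + y) * (term x ⋆ term y) n
      ≈⟨ *-congˡ (term-⋆ x y n) ⟩
    (x + y) * term (x + y) n
      ≈⟨ ∂-term (x + y) n ⟨
    ∂ (term (x + y)) n ∎)

  0<1/!ᴿ : ∀ k → 0# < 1/!ᴿ k
  0<1/!ᴿ k with k ! | k !≢0
  ... | suc m | nz = 0<recip (fromℕ#0 (suc m) {{nz}}) (0<fromℕ m)

  term-nonneg : ∀ {x} → 0# ≤ x → ∀ k → 0# ≤ term x k
  term-nonneg {x} 0≤x k = 0≤* (^-nonneg k) (<⇒≤ (0<1/!ᴿ k))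
    where
    ^-nonneg : ∀ k → 0# ≤ x ^ k
    ^-nonneg zero    = <⇒≤ 0<1
    ^-nonneg (suc k) = 0≤* 0≤x (^-nonneg k)

  term-bound : ∀ {x M} → ∣ x ∣≤ M → ∀ k → ∣ term x k ∣≤ term M k
  term-bound {x} {M} x≤M k = ∣∣≤-* (^-bound k) (∣nonneg∣≤ (<⇒≤ (0<1/!ᴿ k)))
    where
    ^-bound : ∀ k → ∣ x ^ k ∣≤ M ^ k
    ^-bound zero    = ∣nonneg∣≤ (<⇒≤ 0<1)
    ^-bound (suc k) = ∣∣≤-* x≤M (^-bound k)

  P : Carrier → ℕ → Carrier
  P x = Σ< (term x)

  P⟶exp : ∀ x → P x ⟶ exp x
  P⟶exp = exp-series

  exp-cong : ∀ {x y} → x ≈ y → exp x ≈ exp y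
  exp-cong {x} {y} x≈y = ⟶-unique (⟶-cong (Σ<-cong (term-cong x≈y)) refl (P⟶exp x)) (P⟶exp y)

  P-+ : ∀ x y n → (term x ⋆ P y) n ≈ P (x + y) n
  P-+ x y n = trans (sym (Σ<-⋆ (term x) (term y) n)) (Σ<-cong (term-⋆ x y) n)

  -- |P x n P y n - P (x + y) n| ≤ P M n P M n - P (2M) n ≤ P (2M) (2n) - P (2M) n, a null sequence.
  exp-+ : ∀ x y → exp (x + y) ≈ exp x * exp y
  exp-+ x y = begin
    exp (x + y)                                              ≈⟨ solve 2 (λ a b → a := b :+ :- (b :- a)) refl
        (exp (x + y)) (exp x * exp y) ⟩
    exp x * exp y + - (exp x * exp y - exp (x + y))          ≈⟨ +-congˡ (-‿cong (⟶-unique defect⟶ defect⟶0)) ⟩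
    exp x * exp y + - 0#                                     ≈⟨ solve 1 (λ a → a :+ :- con (+ 0) := a) refl
        (exp x * exp y) ⟩
    exp x * exp y                                            ∎
    where
    defect gap : ℕ → Carrier
    defect n = P x n * P y n - P (x + y) n

    bx = bounded-const x
    by = bounded-const y
    ∣x∣<b : ∣ x ∣< proj₁ bx
    ∣x∣<b = proj₂ (proj₂ bx) 0 ℕ.z≤n
    ∣y∣<b : ∣ y ∣< proj₁ by
    ∣y∣<b = proj₂ (proj₂ by) 0 ℕ.z≤n

    M : Carrier
    M = proj₁ bx + proj₁ by

    0≤M : 0# ≤ M
    0≤M = <⇒≤ (0<+ (∣∣<⇒0< ∣x∣<b) (∣∣<⇒0< ∣y∣<b))

    ∣x∣≤M : ∣ x ∣≤ M
    ∣x∣≤M = ∣∣<⇒∣∣≤ (∣∣<-weaken (0≤⇒≤ (<⇒≤ (∣∣<⇒0< ∣y∣<b))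
        (solve 2 (λ a b → b := a :+ b :- a) refl (proj₁ bx) (proj₁ by))) ∣x∣<b)

    ∣y∣≤M : ∣ y ∣≤ M
    ∣y∣≤M = ∣∣<⇒∣∣≤ (∣∣<-weaken (0≤⇒≤ (<⇒≤ (∣∣<⇒0< ∣x∣<b))
        (solve 2 (λ a b → a := a :+ b :- b) refl (proj₁ bx) (proj₁ by))) ∣y∣<b)

    gap n = P (M + M) (n ℕ.+ n) - P (M + M) n

    gap⟶0 : gap ⟶ 0#
    gap⟶0 = ⟶-cong (λ _ → refl) (-‿inverseʳ _)
      (⟶-+ (⟶-subsequence (λ n → n ℕ.+ n) (λ n → ℕ.m≤m+n n n) (P⟶exp (M + M))) (⟶-neg (P⟶exp (M + M))))

    defect≤ : ∀ n → ∣ defect n ∣≤ P M n * P M n - P (M + M) n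
    defect≤ n = ∣∣≤-resp (+-congˡ (-‿cong (P-+ x y n))) (+-congˡ (-‿cong (P-+ M M n)))
      (product-bound (term-bound ∣x∣≤M) (term-bound ∣y∣≤M) {n} {n} ℕ.≤-refl)

    ≤gap : ∀ n → P M n * P M n - P (M + M) n ≤ gap n
    ≤gap n = +-mono-≤ (≤-respʳ (P-+ M M (n ℕ.+ n)) (product≤⋆ (term-nonneg 0≤M) (term-nonneg 0≤M) n n)) ≤-refl

    defect⟶0 : defect ⟶ 0#
    defect⟶0 = squeeze (⟶-cong (λ _ → refl) (solve 0 (:- con (+ 0) := con (+ 0)) refl) (⟶-neg gap⟶0)) gap⟶0
      (λ n → inj₁ (≤-trans (0≤⇒≤ (≤⇒0≤ (≤gap n)) (solve 2 (λ a b → b :- a := (:- a) :- (:- b)) refl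
          (P M n * P M n - P (M + M) n) (gap n))) (proj₁ (defect≤ n))
                  , ≤-trans (proj₂ (defect≤ n)) (≤gap n)))

    defect⟶ : defect ⟶ exp x * exp y - exp (x + y)
    defect⟶ = ⟶-+ (⟶-* (P⟶exp x) (P⟶exp y)) (⟶-neg (P⟶exp (x + y)))

  1+x≤exp-nonneg : ∀ {x} → 0# ≤ x → 1# + x ≤ exp x
  1+x≤exp-nonneg {x} 0≤x = ⟶-≤ 2 (λ n 2≤n → ≤-respˡ (+-cong (term₀ x) (trans (+-identityʳ _) (term₁ x)))
    (Σ<-mono (term-nonneg 0≤x) 2≤n)) (P⟶exp x)

  exp0≈1 : exp 0# ≈ 1#
  exp0≈1 = *-cancelˡ-≈ 0<exp0 (trans (sym (exp-+ 0# 0#)) (trans (exp-cong (+-identityˡ 0#)) (sym (*-identityʳ _))))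
    where
    0<exp0 : 0# < exp 0#
    0<exp0 = <-≤-trans 0<1 (≤-respˡ (+-identityʳ 1#) (1+x≤exp-nonneg ≤-refl))

  exp-inverseʳ : ∀ x → exp x * exp (- x) ≈ 1#
  exp-inverseʳ x = trans (sym (exp-+ x (- x))) (trans (exp-cong (-‿inverseʳ x)) exp0≈1)

  -- With t for `term x`, x * t n = (n + 1) * t (n + 1), so the induction step has n * t (n + 1) ≥ 0
  -- to spare. In the limit, (1 - x) exp x ≤ 1 takes the place of an estimate of the alternating
  -- series of exp (- x).
  [1-x]P≤1-x*term : ∀ {x} → 0# ≤ x → ∀ n → (1# - x) * P x (suc n) ≤ 1# - x * term x n
  [1-x]P≤1-x*term {x} 0≤x zero = ≤-reflexive (begin
    (1# - x) * (term x 0 + 0#)   ≈⟨ *-congˡ (+-congʳ (term₀ x)) ⟩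
    (1# - x) * (1# + 0#)         ≈⟨ solve 1 (λ x → (con (+ 1) :- x) :* (con (+ 1) :+ con (+ 0)) := con (+ 1) :- x :*
        con (+ 1)) refl x ⟩
    1# - x * 1#                  ≈⟨ +-congˡ (-‿cong (*-congˡ (term₀ x))) ⟨
    1# - x * term x 0            ∎)
  [1-x]P≤1-x*term {x} 0≤x (suc n) = ≤-respˡ (sym (trans (*-congˡ (Σ<-last (term x) (suc n))) (distribˡ _ _ _)))
    (≤-trans (+-mono-≤ ([1-x]P≤1-x*term 0≤x n) ≤-refl) (0≤⇒≤ (0≤* (0≤fromℕ n) (term-nonneg 0≤x (suc n))) (begin
      ν n * term x (suc n)
        ≈⟨ solve 2 (λ m t → m :* t := (con (+ 1) :+ m) :* t :- t) refl (ν n) (term x (suc n)) ⟩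
      ∂ (term x) n - term x (suc n)
        ≈⟨ +-congʳ (∂-term x n) ⟩
      x * term x n - term x (suc n)
        ≈⟨ solve 3 (λ x t t′ → x :* t :- t′ := con (+ 1) :- x :* t′ :-
            (con (+ 1) :- x :* t :+ (con (+ 1) :- x) :* t′)) refl x (term x n) (term x (suc n)) ⟩
      1# - x * term x (suc n) - (1# - x * term x n + (1# - x) * term x (suc n)) ∎)))

  [1-x]exp≤1 : ∀ {x} → 0# ≤ x → (1# - x) * exp x ≤ 1#
  [1-x]exp≤1 {x} 0≤x = 0≤⇒≤ (⟶-≤ 1 eventually (⟶-+ (⟶-const 1#) (⟶-neg (⟶-* (⟶-const (1# - x)) (P⟶exp x))))) refl
    where
    eventually : ∀ n → 1 ℕ.≤ n → 0# ≤ 1# - (1# - x) * P x n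
    eventually (suc n) _ = ≤⇒0≤ (≤-trans ([1-x]P≤1-x*term 0≤x n)
      (0≤⇒≤ (0≤* 0≤x (term-nonneg 0≤x n)) (solve 1 (λ y → y := con (+ 1) :- (con (+ 1) :- y)) refl _)))

  -- The sign of x cannot be decided. But the claim is a negation, and the assumption exp x < 1 + x
  -- to be refuted already excludes x < 0, which leaves the nonnegative case.
  1+x≤exp : ∀ x → 1# + x ≤ exp x
  1+x≤exp x exp<1+x = 1+x≤exp-nonneg 0≤x exp<1+x
    where
    -- With s = - x > 0: from exp x < 1 - s follows 1 = exp x exp s < (1 - s) exp s.
    0≤x : 0# ≤ x
    0≤x x<0 = [1-x]exp≤1 (<⇒≤ 0<s) (0<⇒< (*-pos 0<exps (<⇒0< exp<1+x)) (begin
      exp s * (1# + x - exp x)               ≈⟨ solve 3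
          (λ es x ex → es :* (con (+ 1) :+ x :- ex) := (con (+ 1) :- :- x) :* es :- ex :* es) refl (exp s) x (exp x) ⟩
      (1# - - x) * exp s - exp x * exp s     ≈⟨ +-congˡ (-‿cong (exp-inverseʳ x)) ⟩
      (1# - s) * exp s - 1#                  ∎))
      where
      s = - x
      0<s = x<0⇒0<-x x<0
      0<exps : 0# < exp s
      0<exps = <-≤-trans (0<+ 0<1 0<s) (1+x≤exp-nonneg (<⇒≤ 0<s))

  -- exp x is invertible, hence apart from zero. Were it negative, its inverse exp (- x) would be
  -- negative too, yet their sum is at least (1 + x) + (1 - x) = 2.
  0<exp : ∀ x → 0# < exp x
  0<exp x = [ (λ e<0 → ⊥-elim (<.asym 0<2 (2<0 e<0))) , (λ 0<e → 0<e) ]′ (#⇒<⊎> exp#0)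
    where
    0<e*e⁻¹ : 0# < exp x * exp (- x)
    0<e*e⁻¹ = <.<-respʳ-≈ (sym (exp-inverseʳ x)) 0<1

    exp#0 : exp x # 0#
    exp#0 = *#0⇒#0ˡ (0<⇒# 0<e*e⁻¹)

    0<-e⁻¹ : exp x < 0# → 0# < - exp (- x)
    0<-e⁻¹ e<0 = *-cancelʳ-<0 (x<0⇒0<-x e<0)
      (<.<-respʳ-≈ (solve 2 (λ a b → a :* b := (:- b) :* (:- a)) refl (exp x) (exp (- x))) 0<e*e⁻¹)

    2<0 : exp x < 0# → 1# + 1# < 0#
    2<0 e<0 = 0<⇒< (0≤+0< (≤⇒0≤ (1+x≤exp x)) (0≤+0< (≤⇒0≤ (1+x≤exp (- x))) (0<+ (x<0⇒0<-x e<0) (0<-e⁻¹ e<0))))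
      (solve 3 (λ x e f → (e :- (con (+ 1) :+ x)) :+ ((f :- (con (+ 1) :- x)) :+ (:- e :+ :- f)) := con (+ 0) :-
          (con (+ 1) :+ con (+ 1)))
        refl x (exp x) (exp (- x)))

  exp-tangent : ∀ x y → exp x * (y - x) ≤ exp y - exp x
  exp-tangent x y = 0≤⇒≤ (0≤* (<⇒≤ (0<exp x)) (≤⇒0≤ (1+x≤exp (y - x)))) (begin
    exp x * (exp (y - x) - (1# + (y - x)))               ≈⟨ solve 3
        (λ a b d → a :* (b :- (con (+ 1) :+ d)) := a :* b :- a :- a :* d) refl (exp x) (exp (y - x)) (y - x) ⟩
    exp x * exp (y - x) - exp x - exp x * (y - x)        ≈⟨ +-congʳ
        (+-congʳ (trans (sym (exp-+ x (y - x))) (exp-cong (solve 2 (λ x y → x :+ (y :- x) := y) refl x y)))) ⟩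
    exp y - exp x - exp x * (y - x)                      ∎)

  exp-upper-tangent : ∀ x y → exp y - exp x ≤ exp y * (y - x)
  exp-upper-tangent x y = 0≤⇒≤ (≤⇒0≤ (exp-tangent y x))
    (solve 4 (λ x y e f → e :- f :- f :* (x :- y) := f :* (y :- x) :- (f :- e)) refl x y (exp x) (exp y))

  exp-mono-< : ∀ {x y} → x < y → exp x < exp y
  exp-mono-< {x} {y} x<y = 0<⇒< (<-≤-trans (*-pos (0<exp x) (<⇒0< x<y)) (exp-tangent x y)) refl

-- Rules of differentiation

module Derivatives {c ℓ₁ ℓ₂} (R : RealNumbers c ℓ₁ ℓ₂) {ℓ} (I : Analysis.Interval R ℓ) where
  open RealNumbers R
  open Analysis R
  open OrderedFieldProperties orderedHeytingField
  open IntegerSolver commutativeRing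

  -- δ and η cannot be compared outright, but cotransitivity at δ/2 < δ gives δ/2 < η or η < δ,
  -- which is enough.
  minimum : ∀ {δ η} → 0# < δ → 0# < η → ∃[ ζ ] 0# < ζ × ζ ≤ δ × ζ ≤ η
  minimum {δ} {η} 0<δ 0<η =
    [ (λ δ/2<η → δ * ½ , *-pos 0<δ 0<½ , <⇒≤ δ/2<δ , <⇒≤ δ/2<η) , (λ η<δ → η , 0<η , <⇒≤ η<δ , ≤-refl) ]′
        (<-cotrans δ/2<δ η)
    where
    δ/2<δ : δ * ½ < δ
    δ/2<δ = 0<⇒< (*-pos 0<δ 0<½) (trans (solve 1 (λ h → h := h :+ h :- h) refl (δ * ½)) (+-congʳ (½+½ δ)))

  module At (x : Carrier) (x∈I : Mem I x) where

    punctured : FilterBase _ _ _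
    punctured = record
      { Index = ∃[ y ] Mem I y × y # x
      ; Stage = ∃[ δ ] 0# < δ
      ; At    = λ (δ , _) (y , _) → Within δ y x
      ; start = 1# , 0<1
      ; meet  = λ (δ , 0<δ) (η , 0<η) → let (ζ , 0<ζ , ζ≤δ , ζ≤η) = minimum 0<δ 0<η in
                  (ζ , 0<ζ) , λ near → ∣∣<-weaken ζ≤δ near , ∣∣<-weaken ζ≤η near
      }

    open Limits R punctured public
    open FilterBase punctured using (Index) public

    at : FunctionOn I → Function
    at f (y , y∈I , _) = f y y∈I

    Δ : FunctionOn I → Function
    Δ f n = at f n - f x x∈I

    1/Δ : Function
    1/Δ (y , _ , y#x) = proj₁ (#⇒invertible y#x)

    quotient : FunctionOn I → Function
    quotient f n = Δ f n * 1/Δ n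

    Δ*1/Δ : ∀ n → (proj₁ n - x) * 1/Δ n ≈ 1#
    Δ*1/Δ (y , _ , y#x) = proj₂ (proj₂ (#⇒invertible y#x))

    quotient*Δ : ∀ f n → quotient f n * (proj₁ n - x) ≈ Δ f n
    quotient*Δ f n = trans (solve 3 (λ d i t → d :* i :* t := d :* (t :* i)) refl (Δ f n) (1/Δ n) (proj₁ n - x))
      (trans (*-congˡ (Δ*1/Δ n)) (*-identityʳ _))

    Δ-null : Null (λ n → proj₁ n - x)
    Δ-null ε 0<ε = (ε , 0<ε) , λ _ near → near

    continuous : ∀ {f l} → quotient f ⟶ l → at f ⟶ f x x∈I
    continuous {f} f′ = null-cong (λ n → trans (*-comm _ _) (quotient*Δ f n)) (null-* Δ-null (⟶⇒bounded f′))

    -- 1/Δ has the sign of y - x.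
    between-quotients : ∀ n {a d b} → a ≤ d → d ≤ b →
      (a * 1/Δ n ≤ d * 1/Δ n × d * 1/Δ n ≤ b * 1/Δ n) ⊎ (b * 1/Δ n ≤ d * 1/Δ n × d * 1/Δ n ≤ a * 1/Δ n)
    between-quotients n@(y , _ , y#x) {a} {d} {b} a≤d d≤b =
      [ (λ y<x → inj₂ (flip (0<-1/Δ y<x) d≤b , flip (0<-1/Δ y<x) a≤d))
      , (λ x<y → inj₁ (*-monoˡ-≤ (<⇒≤ (0<1/Δ x<y)) a≤d , *-monoˡ-≤ (<⇒≤ (0<1/Δ x<y)) d≤b)) ]′ (#⇒<⊎> y#x)
      where
      0<1/Δ : x < y → 0# < 1/Δ n
      0<1/Δ x<y = *-cancelʳ-<0 (<⇒0< x<y) (<.<-respʳ-≈ (trans (sym (Δ*1/Δ n)) (*-comm _ _)) 0<1)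

      0<-1/Δ : y < x → 0# < - 1/Δ n
      0<-1/Δ y<x = *-cancelʳ-<0 (<⇒0< y<x) (<.<-respʳ-≈ (trans (sym (Δ*1/Δ n))
        (solve 3 (λ y x i → (y :- x) :* i := (:- i) :* (x :- y)) refl y x (1/Δ n))) 0<1)

      flip : ∀ {p q} → 0# < - 1/Δ n → p ≤ q → q * 1/Δ n ≤ p * 1/Δ n
      flip {p} {q} 0<-i p≤q = 0≤⇒≤ (0≤* (<⇒≤ 0<-i) (≤⇒0≤ p≤q))
          (solve 3 (λ p q i → (:- i) :* (q :- p) := p :* i :- q :* i) refl p q (1/Δ n))

    quotient-squeeze : ∀ {f l} {lo hi : Function} → (∀ n → lo n ≤ Δ f n × Δ f n ≤ hi n) →
      (λ n → lo n * 1/Δ n) ⟶ l → (λ n → hi n * 1/Δ n) ⟶ l → quotient f ⟶ l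
    quotient-squeeze bounds lo⟶ hi⟶ = squeeze lo⟶ hi⟶ (λ n → between-quotients n (proj₁ (bounds n)) (proj₂ (bounds n)))

  HasDerivative : (f f′ : FunctionOn I) → Set _
  HasDerivative f f′ = ∀ x x∈I → let open At x x∈I in quotient f ⟶ f′ x x∈I

  toIsDerivative : ∀ {f f′} → HasDerivative f f′ → IsDerivative I f f′
  toIsDerivative d x x∈I ε 0<ε with d x x∈I ε 0<ε
  ... | (δ , 0<δ) , close = δ , 0<δ , λ y y∈I y#x near → close (y , y∈I , y#x) near

  infix 4 _≈ᶠ_
  _≈ᶠ_ : (f g : FunctionOn I) → Set _
  f ≈ᶠ g = ∀ x x∈I → f x x∈I ≈ g x x∈I

  infixl 6 _+ᶠ_
  infixl 7 _*ᶠ_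
  _+ᶠ_ _*ᶠ_ : (f g : FunctionOn I) → FunctionOn I
  (f +ᶠ g) x x∈I = f x x∈I + g x x∈I
  (f *ᶠ g) x x∈I = f x x∈I * g x x∈I

  derivative-cong : ∀ {f g f′ g′} → f ≈ᶠ g → f′ ≈ᶠ g′ → HasDerivative f f′ → HasDerivative g g′
  derivative-cong f≈g f′≈g′ d x x∈I = ⟶-cong
    (λ (y , y∈I , _) → *-congʳ (+-cong (f≈g y y∈I) (-‿cong (f≈g x x∈I)))) (f′≈g′ x x∈I) (d x x∈I)
    where open At x x∈I

  derivative-+ : ∀ {f g f′ g′} → HasDerivative f f′ → HasDerivative g g′ → HasDerivative (f +ᶠ g) (f′ +ᶠ g′)
  derivative-+ {f} {g} df dg x x∈I = ⟶-cong
    (λ n → solve 5 (λ a b a′ b′ i → (a :- a′) :* i :+ (b :- b′) :* i := (a :+ b :- (a′ :+ b′)) :* i) refl (at f n)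
        (at g n) (f x x∈I) (g x x∈I) (1/Δ n))
    refl (⟶-+ (df x x∈I) (dg x x∈I))
    where open At x x∈I

  derivative-* : ∀ {f g f′ g′} → HasDerivative f f′ → HasDerivative g g′ → HasDerivative (f *ᶠ g) (f′ *ᶠ g +ᶠ f *ᶠ g′)
  derivative-* {f} {g} df dg x x∈I = ⟶-cong
    (λ n → solve 5 (λ a b a′ b′ i → (a :- a′) :* i :* b :+ a′ :* ((b :- b′) :* i) := (a :* b :- a′ :* b′) :* i) refl
        (at f n) (at g n) (f x x∈I) (g x x∈I) (1/Δ n))
    refl (⟶-+ (⟶-* (df x x∈I) (continuous {g} (dg x x∈I))) (⟶-* (⟶-const (f x x∈I)) (dg x x∈I)))
    where open At x x∈I

  derivative-scale : ∀ {f f′} a → HasDerivative f f′ → HasDerivative (λ x x∈I → f x x∈I * a) (λ x x∈I → f′ x x∈I * a)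
  derivative-scale {f} a df x x∈I = ⟶-cong
    (λ n → solve 4 (λ y z i a → (y :- z) :* i :* a := (y :* a :- z :* a) :* i) refl (at f n) (f x x∈I) (1/Δ n) a)
    refl (⟶-* (df x x∈I) (⟶-const a))
    where open At x x∈I

  derivative-id : HasDerivative (λ x _ → x) (λ _ _ → 1#)
  derivative-id x x∈I = ⟶-cong (λ n → sym (Δ*1/Δ n)) refl (⟶-const 1#)
    where open At x x∈I

  -- If b = k - f and b r = 1, then r y - r x = r y r x (f y - f x).
  derivative-inverse : ∀ {f f′ r} k → (∀ x x∈I → 0# < k - f x x∈I) → (∀ x x∈I → (k - f x x∈I) * r x x∈I ≈ 1#) →
      (∀ x x∈I → 0# < r x x∈I) →
    HasDerivative f f′ → HasDerivative r (f′ *ᶠ r *ᶠ r)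
  derivative-inverse {f} {f′} {r} k 0<b br≈1 0<r df x x∈I = ⟶-cong
    (λ n@(y , y∈I , _) → trans (solve 5 (λ a a′ i s s′ → (a :- a′) :* i :* s :* s′ := ((a :- a′) :* (s :* s′)) :* i)
        refl (at f n) (f x x∈I) (1/Δ n) (at r n) (r x x∈I))
       (*-congʳ (difference (br≈1 y y∈I) (br≈1 x x∈I))))
    refl (⟶-* (⟶-* (df x x∈I) r⟶) (⟶-const (r x x∈I)))
    where
    open At x x∈I

    r⟶ : at r ⟶ r x x∈I
    r⟶ = ⟶-inverse (⟶-+ (⟶-const k) (⟶-neg (continuous {f} (df x x∈I)))) (0<b x x∈I) (br≈1 x x∈I)
      (λ (y , y∈I , _) → br≈1 y y∈I) (λ (y , y∈I , _) → 0<r y y∈I)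

    difference : ∀ {a a′ s s′} → (k - a) * s ≈ 1# → (k - a′) * s′ ≈ 1# → (a - a′) * (s * s′) ≈ s - s′
    difference {a} {a′} {s} {s′} p p′ = trans
      (solve 5 (λ k a a′ s s′ → (a :- a′) :* (s :* s′) := (k :- a′) :* s′ :* s :- (k :- a) :* s :* s′) refl k a a′ s s′)
      (+-cong (trans (*-congʳ p′) (*-identityˡ s)) (-‿cong (trans (*-congʳ p) (*-identityˡ s′))))

  -- The tangent inequality says that w is a constant multiple of exp ∘ m; it squeezes m y - m x between
  -- (w y - w x) / w y and (w y - w x) / w x.
  derivative-log : ∀ {w w′ v m} → (∀ x x∈I → 0# < w x x∈I) → (∀ x x∈I → w x x∈I * v x x∈I ≈ 1#) →
    (∀ x x∈I y y∈I → w x x∈I * (m y y∈I - m x x∈I) ≤ w y y∈I - w x x∈I) →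
    HasDerivative w w′ → HasDerivative m (w′ *ᶠ v)
  derivative-log {w} {w′} {v} {m} 0<w wv≈1 tangent dw x x∈I = quotient-squeeze {m} bounds
    (rearrange (at v) (⟶-* (dw x x∈I) v⟶)) (rearrange (λ _ → v x x∈I) (⟶-* (dw x x∈I) (⟶-const (v x x∈I))))
    where
    open At x x∈I

    0<v : ∀ y y∈I → 0# < v y y∈I
    0<v y y∈I = *-cancelʳ-<0 (0<w y y∈I) (<.<-respʳ-≈ (trans (sym (wv≈1 y y∈I)) (*-comm _ _)) 0<1)

    v⟶ : at v ⟶ v x x∈I
    v⟶ = ⟶-inverse (continuous {w} (dw x x∈I)) (0<w x x∈I) (wv≈1 x x∈I) (λ (y , y∈I , _) → wv≈1 y y∈I)
        (λ (y , y∈I , _) → 0<v y y∈I)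

    rearrange : ∀ (h : Function) {l} → (λ n → quotient w n * h n) ⟶ l → (λ n → Δ w n * h n * 1/Δ n) ⟶ l
    rearrange h = ⟶-cong (λ n → solve 3 (λ d i h → d :* i :* h := d :* h :* i) refl (Δ w n) (1/Δ n) (h n)) refl

    cancel-v : ∀ y y∈I z → w y y∈I * z * v y y∈I ≈ z
    cancel-v y y∈I z = trans (solve 3 (λ w z v → w :* z :* v := w :* v :* z) refl (w y y∈I) z (v y y∈I))
        (trans (*-congʳ (wv≈1 y y∈I)) (*-identityˡ z))

    bounds : ∀ n → Δ w n * at v n ≤ Δ m n × Δ m n ≤ Δ w n * v x x∈I
    bounds n@(y , y∈I , _) =
      0≤⇒≤ (≤⇒0≤ (≤-respˡ (cancel-v y y∈I _) (*-monoˡ-≤ (<⇒≤ (0<v y y∈I)) (tangent y y∈I x x∈I))))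
        (solve 5 (λ a a′ b b′ v → (a′ :- a) :* v :- (b′ :- b) := (b :- b′) :- (a :- a′) :* v) refl (at w n) (w x x∈I)
            (at m n) (m x x∈I) (at v n)) ,
      ≤-respˡ (cancel-v x x∈I _) (*-monoˡ-≤ (<⇒≤ (0<v x x∈I)) (tangent x x∈I y y∈I))

  module _ (E : ElementaryFunctions R) where
    open ElementaryFunctions E
    open Exponential R E using (exp-mono-<; exp-tangent; exp-upper-tangent; 0<exp)

    -- The upper tangent has slope exp (f y), so the squeeze needs continuity of exp ∘ f at x first.
    -- The same two inequalities give it once exp ∘ f is bounded, and near x it is below exp (f x +
    -- 1) by monotonicity.
    derivative-exp∘ : ∀ {f f′} → HasDerivative f f′ →
      HasDerivative (λ x x∈I → exp (f x x∈I)) (λ x x∈I → exp (f x x∈I) * f′ x x∈I)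
    derivative-exp∘ {f} df x x∈I = quotient-squeeze {λ y y∈I → exp (f y y∈I)}
      (λ n → exp-tangent (f x x∈I) (at f n) , exp-upper-tangent (f x x∈I) (at f n))
      (⟶-cong (λ n → sym (*-assoc _ _ _)) refl (⟶-* (⟶-const (exp (f x x∈I))) (df x x∈I)))
      (⟶-cong (λ n → sym (*-assoc _ _ _)) refl (⟶-* exp∘f⟶ (df x x∈I)))
      where
      open At x x∈I
      l = f x x∈I

      exp∘f-bounded : Bounded (exp ∘ at f)
      exp∘f-bounded = exp (l + 1#) , eventually-map
        (λ n (_ , near) → 0<⇒< (0<+ (0<exp (at f n)) (0<exp (l + 1#)))
            (solve 2 (λ a b → a :+ b := a :- (:- b)) refl (exp (at f n)) (exp (l + 1#))) ,
          exp-mono-< (0<⇒< (<⇒0< near) (solve 2 (λ a l → con (+ 1) :- (a :- l) := l :+ con (+ 1) :- a) refl (at f n)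
              l)))
        (continuous {f} (df x x∈I) 1# 0<1)

      exp∘f⟶ : (exp ∘ at f) ⟶ exp l
      exp∘f⟶ = null-cong (λ n → solve 1 (λ d → d :- con (+ 0) := d) refl _) (squeeze {l = 0#}
        (as-limit (null-* (continuous {f} (df x x∈I)) (bounded-const (exp l))))
        (as-limit (null-* (continuous {f} (df x x∈I)) exp∘f-bounded))
        (λ n → inj₁ (≤-respˡ (*-comm _ _) (exp-tangent l (at f n)) , ≤-respʳ (*-comm _ _)
            (exp-upper-tangent l (at f n)))))
        where
        as-limit : ∀ {h} → Null h → h ⟶ 0#
        as-limit {h} = null-cong (λ n → solve 1 (λ d → d := d :- con (+ 0)) refl (h n))

-- The function G and its logarithm

module LogAbsoluteMonotonicity {c ℓ₁ ℓ₂} (R : RealNumbers c ℓ₁ ℓ₂) (E : ElementaryFunctions R) where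
  open RealNumbers R
  open ElementaryFunctions E
  open Analysis R
  open OrderedFieldProperties orderedHeytingField
  open IntegerSolver commutativeRing
  open Exponential R E
  open Relation.Binary.Reasoning.Setoid setoid

  I : Interval ℓ₂
  I = Below (ln2 E)

  open Derivatives R I

  two four : Carrier
  two  = fromℕ 2
  four = fromℕ 4

  two≈1+1 : two ≈ 1# + 1#
  two≈1+1 = +-congˡ (+-identityʳ 1#)

  exp<2 : ∀ x → x < ln2 E → exp x < two
  exp<2 x x<ln2 = <.<-respʳ-≈ (exp-ln two (0<fromℕ 1)) (exp-mono-< x<ln2)

  0<2-exp : ∀ x → x < ln2 E → 0# < two - exp x
  0<2-exp x x<ln2 = <⇒0< (exp<2 x x<ln2)

  radicand*exp : ∀ x → radicand E x * exp x ≈ two - exp x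
  radicand*exp x = begin
    (two * exp (- x) - 1#) * exp x          ≈⟨ solve 3 (λ t e f → (t :* f :- con (+ 1)) :* e := t :* (e :* f) :- e)
        refl two (exp x) (exp (- x)) ⟩
    two * (exp x * exp (- x)) - exp x       ≈⟨ +-congʳ (trans (*-congˡ (exp-inverseʳ x)) (*-identityʳ two)) ⟩
    two - exp x                             ∎

  0<radicand : ∀ x → x < ln2 E → 0# < radicand E x
  0<radicand x x<ln2 = *-cancelʳ-<0 (0<exp x) (<.<-respʳ-≈ (sym (radicand*exp x)) (0<2-exp x x<ln2))

  0<sqrt : ∀ {x} (0≤x : 0# ≤ x) → 0# < x → 0# < sqrt x 0≤x
  0<sqrt {x} 0≤x 0<x = [ (λ s<0 → ⊥-elim (0≤sqrt x 0≤x s<0)) , (λ 0<s → 0<s) ]′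
    (#⇒<⊎> (*#0⇒#0ˡ (0<⇒# (<.<-respʳ-≈ (sym (sqrt*sqrt x 0≤x)) 0<x))))

  0<denominator : ∀ x (x<ln2 : x < ln2 E) → 0# < four * sqrt (radicand E x) (<⇒≤ (0<radicand x x<ln2))
  0<denominator x x<ln2 = *-pos (0<fromℕ 3) (0<sqrt _ (0<radicand x x<ln2))

  G-defined : ∀ x → x < ln2 E → GDefinedAt E x
  G-defined x x<ln2 = record
    { 0≤radicand    = <⇒≤ (0<radicand x x<ln2)
    ; denominator#0 = 0<⇒# (0<denominator x x<ln2)
    }

  e u g : FunctionOn I
  e x _     = exp x
  u x x<ln2 = 0<2-exp x x<ln2 ⁻¹₊
  g x x<ln2 = G E x (G-defined x x<ln2)

  0<u : ∀ x x<ln2 → 0# < u x x<ln2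
  0<u x x<ln2 = 0<⁻¹₊ (0<2-exp x x<ln2)

  [2-e]u≈1 : ∀ x x<ln2 → (two - exp x) * u x x<ln2 ≈ 1#
  [2-e]u≈1 x x<ln2 = *⁻¹₊ (0<2-exp x x<ln2)

  0<g : Positive I g
  0<g x x<ln2 = 0<recip (0<⇒# (0<denominator x x<ln2)) (0<denominator x x<ln2)

  sixteen : Carrier
  sixteen = four * four

  16g²≈eu : ∀ x x<ln2 → sixteen * (g x x<ln2 * g x x<ln2) ≈ exp x * u x x<ln2
  16g²≈eu x x<ln2 = begin
    sixteen * (γ * γ)                           ≈⟨ trans (*-congˡ ([2-e]u≈1 x x<ln2)) (*-identityʳ _) ⟨
    sixteen * (γ * γ) * ((two - exp x) * υ)     ≈⟨ *-congˡ
        (*-congʳ (trans (*-congʳ (sqrt*sqrt _ 0≤r)) (radicand*exp x))) ⟨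
    sixteen * (γ * γ) * (s * s * exp x * υ)     ≈⟨ solve 5
        (λ f γ s e υ → (f :* f) :* (γ :* γ) :* (s :* s :* e :* υ) := (f :* s :* γ) :* (f :* s :* γ) :* (e :* υ)) refl
        four γ s (exp x) υ ⟩
    (four * s * γ) * (four * s * γ) * (exp x * υ)   ≈⟨ *-congʳ (*-cong dγ≈1 dγ≈1) ⟩
    1# * 1# * (exp x * υ)                       ≈⟨ solve 1 (λ w → con (+ 1) :* con (+ 1) :* w := w) refl (exp x * υ) ⟩
    exp x * υ                                   ∎
    where
    γ = g x x<ln2
    υ = u x x<ln2
    0≤r = <⇒≤ (0<radicand x x<ln2)
    s = sqrt (radicand E x) 0≤r

    dγ≈1 : four * s * γ ≈ 1#
    dγ≈1 = *-inverseʳ (0<⇒# (0<denominator x x<ln2))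

  -- Doubling the logarithm removes the square root: exp M = g² = e u / 16.
  L M : FunctionOn I
  L x x<ln2 = ln (g x x<ln2) (0<g x x<ln2)
  M = L +ᶠ L

  e′ : HasDerivative e e
  e′ = derivative-cong (λ _ _ → refl) (λ x _ → *-identityʳ (exp x)) (derivative-exp∘ E derivative-id)

  u′ : HasDerivative u (e *ᶠ u *ᶠ u)
  u′ = derivative-inverse {f = e} two 0<2-exp [2-e]u≈1 0<u e′

  16exp[M]≈eu : ∀ x x<ln2 → sixteen * exp (M x x<ln2) ≈ exp x * u x x<ln2
  16exp[M]≈eu x x<ln2 = trans (*-congˡ (trans (exp-+ _ _)
      (*-cong (exp-ln _ (0<g x x<ln2)) (exp-ln _ (0<g x x<ln2))))) (16g²≈eu x x<ln2)

  eu-tangent : ∀ x x<ln2 y y<ln2 → exp x * u x x<ln2 * (M y y<ln2 - M x x<ln2) ≤ exp y * u y y<ln2 - exp x * u x x<ln2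
  eu-tangent x x<ln2 y y<ln2 = ≤-respˡ
    (trans (sym (*-assoc _ _ _)) (*-congʳ (16exp[M]≈eu x x<ln2)))
    (≤-respʳ (trans (solve 3 (λ s a b → s :* (a :- b) := s :* a :- s :* b) refl sixteen _ _)
        (+-cong (16exp[M]≈eu y y<ln2) (-‿cong (16exp[M]≈eu x x<ln2))))
      (*-monoʳ-≤ (<⇒≤ (*-pos (0<fromℕ 3) (0<fromℕ 3))) (exp-tangent (M x x<ln2) (M y y<ln2))))

  -- (e u)′ / (e u) = 1 + e u, which equals 2u because (2 - e) u = 1. The inverse of e u is taken in
  -- the form (2 - e) exp (- x).
  M′ : HasDerivative M (u +ᶠ u)
  M′ = derivative-cong {f = M} (λ _ _ → refl) simplify
    (derivative-log {w = e *ᶠ u} {v = λ x _ → (two - exp x) * exp (- x)} {m = M}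
      (λ x x<ln2 → *-pos (0<exp x) (0<u x x<ln2))
      (λ x x<ln2 → trans (solve 4 (λ e u d f → (e :* u) :* (d :* f) := (d :* u) :* (e :* f)) refl (exp x) (u x x<ln2)
          (two - exp x) (exp (- x)))
        (trans (*-cong ([2-e]u≈1 x x<ln2) (exp-inverseʳ x)) (*-identityˡ 1#)))
      eu-tangent (derivative-* {f = e} {g = u} e′ u′))
    where
    simplify : ∀ x x<ln2 → (exp x * u x x<ln2 + exp x * (exp x * u x x<ln2 * u x x<ln2)) *
        ((two - exp x) * exp (- x)) ≈ u x x<ln2 + u x x<ln2
    simplify x x<ln2 = begin
      (ε * υ + ε * (ε * υ * υ)) * ((two - ε) * ε⁻¹)
        ≈⟨ solve 4 (λ ε υ t f → (ε :* υ :+ ε :* (ε :* υ :* υ)) :* ((t :- ε) :* f) := (ε :* f) :* ((t :- ε) :* υ) :*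
            (con (+ 1) :+ ε :* υ)) refl ε υ two ε⁻¹ ⟩
      (ε * ε⁻¹) * ((two - ε) * υ) * (1# + ε * υ)
        ≈⟨ *-congʳ (trans (*-cong (exp-inverseʳ x) ([2-e]u≈1 x x<ln2)) (*-identityˡ 1#)) ⟩
      1# * (1# + ε * υ)
        ≈⟨ *-congˡ (+-congʳ ([2-e]u≈1 x x<ln2)) ⟨
      1# * ((two - ε) * υ + ε * υ)
        ≈⟨ solve 3 (λ t ε υ → con (+ 1) :* ((t :- ε) :* υ :+ ε :* υ) := t :* υ) refl two ε υ ⟩
      two * υ
        ≈⟨ *-congʳ two≈1+1 ⟩
      (1# + 1#) * υ
        ≈⟨ solve 1 (λ υ → (con (+ 1) :+ con (+ 1)) :* υ := υ :+ υ) refl υ ⟩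
      υ + υ ∎
      where
      ε = exp x
      ε⁻¹ = exp (- x)
      υ = u x x<ln2

  L′ : HasDerivative L u
  L′ = derivative-cong (λ x x<ln2 → halve (L x x<ln2)) (λ x x<ln2 → halve (u x x<ln2)) (derivative-scale {f = M} ½ M′)
    where
    halve : ∀ z → (z + z) * ½ ≈ z
    halve z = trans (distribʳ _ _ _) (½+½ z)

  -- g is recovered as exp ∘ L, so neither `sqrt` nor the reciprocal defining g is ever
  -- differentiated.
  g′ : HasDerivative g (g *ᶠ u)
  g′ = derivative-cong {f = λ x x<ln2 → exp (L x x<ln2)} (λ x x<ln2 → exp-ln _ (0<g x x<ln2))
      (λ x x<ln2 → *-congʳ (exp-ln _ (0<g x x<ln2)))
    (derivative-exp∘ E {f = L} L′)

  -- Syntax without subtraction: differentiation becomes a recursive function on terms and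
  -- nonnegativity a structural induction, so all orders are treated at once.
  data Expr : Set where
    ′e ′u ′g  : Expr
    _⊕_ _⊗_   : Expr → Expr → Expr

  ⟦_⟧ : Expr → FunctionOn I
  ⟦ ′e ⟧    = e
  ⟦ ′u ⟧    = u
  ⟦ ′g ⟧    = g
  ⟦ s ⊕ t ⟧ = ⟦ s ⟧ +ᶠ ⟦ t ⟧
  ⟦ s ⊗ t ⟧ = ⟦ s ⟧ *ᶠ ⟦ t ⟧

  D : Expr → Expr
  D ′e      = ′e
  D ′u      = (′e ⊗ ′u) ⊗ ′u
  D ′g      = ′g ⊗ ′u
  D (s ⊕ t) = D s ⊕ D t
  D (s ⊗ t) = (D s ⊗ t) ⊕ (s ⊗ D t)

  D^ : ℕ → Expr → Expr
  D^ zero    t = t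
  D^ (suc n) t = D (D^ n t)

  ⟦⟧-derivative : ∀ t → HasDerivative ⟦ t ⟧ ⟦ D t ⟧
  ⟦⟧-derivative ′e      = e′
  ⟦⟧-derivative ′u      = u′
  ⟦⟧-derivative ′g      = g′
  ⟦⟧-derivative (s ⊕ t) = derivative-+ {f = ⟦ s ⟧} {g = ⟦ t ⟧} (⟦⟧-derivative s) (⟦⟧-derivative t)
  ⟦⟧-derivative (s ⊗ t) = derivative-* {f = ⟦ s ⟧} {g = ⟦ t ⟧} (⟦⟧-derivative s) (⟦⟧-derivative t)

  ⟦⟧-nonneg : ∀ t x x<ln2 → 0# ≤ ⟦ t ⟧ x x<ln2
  ⟦⟧-nonneg ′e x x<ln2      = <⇒≤ (0<exp x)
  ⟦⟧-nonneg ′u x x<ln2      = <⇒≤ (0<u x x<ln2)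
  ⟦⟧-nonneg ′g x x<ln2      = <⇒≤ (0<g x x<ln2)
  ⟦⟧-nonneg (s ⊕ t) x x<ln2 = 0≤+ (⟦⟧-nonneg s x x<ln2) (⟦⟧-nonneg t x x<ln2)
  ⟦⟧-nonneg (s ⊗ t) x x<ln2 = 0≤* (⟦⟧-nonneg s x x<ln2) (⟦⟧-nonneg t x x<ln2)

  -- Order 0 stands apart: ln g is not given by a term and may be negative. From order 1 on these
  -- are the iterated derivatives of u.
  lnDerivatives : ℕ → FunctionOn I
  lnDerivatives zero    = L
  lnDerivatives (suc n) = ⟦ D^ n ′u ⟧

  lnDerivatives-step : ∀ n → HasDerivative (lnDerivatives n) (lnDerivatives (suc n))
  lnDerivatives-step zero    = L′
  lnDerivatives-step (suc n) = ⟦⟧-derivative (D^ n ′u)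

  g-logAbsolutelyMonotonic : LogAbsolutelyMonotonic E I g
  g-logAbsolutelyMonotonic = record
    { positive = 0<g
    ; smooth   = (λ n → ⟦ D^ n ′g ⟧) , record
      { base = λ _ _ → refl
      ; step = λ n → toIsDerivative {f = ⟦ D^ n ′g ⟧} (⟦⟧-derivative (D^ n ′g))
      }
    ; lnDerivative = lnDerivatives
    ; lnDerivative-isDerivative = record
      { base = λ _ _ → refl
      ; step = λ n → toIsDerivative {f = lnDerivatives n} (lnDerivatives-step n)
      }
    ; lnDerivative-nonneg = λ { (suc n) _ → ⟦⟧-nonneg (D^ n ′u) }
    }

theorem6p2 : ∀ c ℓ₁ ℓ₂ →
    ((R : RealNumbers c ℓ₁ ℓ₂) (E : ElementaryFunctions R) →
      let open RealNumbers R using (_<_)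
          open Analysis R
      in Σ[ G-defined ∈ (∀ x → x < ln2 E → GDefinedAt E x) ]
           LogAbsolutelyMonotonic E (Below (ln2 E)) (λ x x<ln2 → G E x (G-defined x x<ln2)))
    × (PositiveFrom 0 oddSequence × IncreasingFrom 0 oddSequence × LogConvexFrom 0 oddSequence)
    × (PositiveFrom 1 evenSequence × IncreasingFrom 1 evenSequence × LogConvexFrom 1 evenSequence)
theorem6p2 c ℓ₁ ℓ₂ =
  (λ R E → LogAbsoluteMonotonicity.G-defined R E , LogAbsoluteMonotonicity.g-logAbsolutelyMonotonic R E) ,
  RationalSequences.oddSequence-properties ,
  RationalSequences.evenSequence-properties
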